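{- Let $W=S_n$ and let $(X,Y)$ be an arbitrary splitting of $W$. Then $X=W/Y$ and $Y=[e,u]_R$ for some separable permutation $u\in S_n$.
   Context: $S_n$ is the symmetric group, with product $(uv)(i)=u(v(i))$, viewed as the Weyl group of type $A_{n-1}$ generated by adjacent transpositions $s_i=(i,i+1)$. The length $\ell(w)$ is the number of inversions $\{(i,j):i<j,\ w(i)>w(j)\}$. Right weak order: $v\leq_R w$ iff $w=vz$ with $\ell(w)=\ell(v)+\ell(z)$; $[e,u]_R=\{v: v\leq_R u\}$. A permutation is separable if it avoids the patterns $3142$ and $2413$, i.e. there are no indices $i_1<i_2<i_3<i_4$ with $w(i_1)w(i_2)w(i_3)w(i_4)$ in the same relative order as $3142$ or $2413$. For $U\subseteq W$, the generalized quotient is $W/U=\{w\in W:\ell(wu)=\ell(w)+\ell(u)\ \forall u\in U\}$. A pair $(X,Y)$ of subsets of $W$ is a splitting if the multiplication map $X\times Y\to W$, $(x,y)\mapsto xy$, is a bijection with $\ell(xy)=\ell(x)+\ell(y)$ for all $x\in X,y\in Y$. -}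

module Defs where

open import Data.Fin.Base using (Fin; _<_)
open import Data.Fin.Permutation using (Permutation′; _⟨$⟩ʳ_; _∘ₚ_; _≈_)
open import Data.Fin.Properties using (_<?_)
open import Data.List.Base using (allFin; cartesianProduct; filter; length)
open import Data.Nat.Base as ℕ using (ℕ; _+_)
open import Data.Product.Base using (Σ; ∃; _×_; _,_; proj₁)
open import Data.Product.Relation.Binary.Pointwise.NonDependent using (Pointwise)
open import Data.Vec.Base using (Vec; []; _∷_; lookup)
open import Function.Base using (_on_)
open import Function.Bundles using (_⇔_)
open import Function.Definitions using (Bijective)
open import Level using (Level; 0ℓ; _⊔_)
open import Relation.Binary.Core using (Rel)
open import Relation.Binary.Definitions using (_Respects_)
open import Relation.Binary.PropositionalEquality.Core using (_≡_)
open import Relation.Nullary.Decidable using (_×-dec_)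
open import Relation.Nullary.Negation using (¬_)
open import Relation.Unary using (Pred; _∈_; Decidable)

private
  variable
    a b : Level
    k n : ℕ

-- (u · v)(i) = u (v i), whereas _∘ₚ_ composes in diagrammatic order.
infixl 7 _·_

_·_ : Permutation′ n → Permutation′ n → Permutation′ n
u · v = v ∘ₚ u

Inversion : Permutation′ n → Pred (Fin n × Fin n) 0ℓ
Inversion w (i , j) = i < j × (w ⟨$⟩ʳ j) < (w ⟨$⟩ʳ i)

inversion? : (w : Permutation′ n) → Decidable (Inversion w)
inversion? w (i , j) = (i <? j) ×-dec ((w ⟨$⟩ʳ j) <? (w ⟨$⟩ʳ i))

ℓ : Permutation′ n → ℕ
ℓ {n} w = length (filter (inversion? w) (cartesianProduct (allFin n) (allFin n)))

infix 4 _≤R_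

_≤R_ : Rel (Permutation′ n) 0ℓ
_≤R_ {n} v w = Σ (Permutation′ n) λ z → (w ≈ v · z) × (ℓ w ≡ ℓ v + ℓ z)

[e,_]R : Permutation′ n → Pred (Permutation′ n) 0ℓ
[e, u ]R v = v ≤R u

-- The pattern is given in one-line notation; positions f are chosen so that
-- the values of w at them are in the same relative order as the pattern.
Contains : Vec ℕ k → Permutation′ n → Set
Contains {k} {n} p w = Σ (Fin k → Fin n) λ f →
  (∀ {i j} → i < j → f i < f j) ×
  (∀ i j → (lookup p i ℕ.< lookup p j) ⇔ ((w ⟨$⟩ʳ f i) < (w ⟨$⟩ʳ f j)))

Separable : Permutation′ n → Set
Separable w = ¬ Contains (3 ∷ 1 ∷ 4 ∷ 2 ∷ []) w × ¬ Contains (2 ∷ 4 ∷ 1 ∷ 3 ∷ []) w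

-- The generalized quotient W/U.
W/ : Pred (Permutation′ n) a → Pred (Permutation′ n) a
W/ U w = ∀ u → u ∈ U → ℓ (w · u) ≡ ℓ w + ℓ u

multiply : (X : Pred (Permutation′ n) a) (Y : Pred (Permutation′ n) b) →
           ∃ X × ∃ Y → Permutation′ n
multiply X Y ((x , _) , (y , _)) = x · y

-- Permutations carry their inverse and are compared pointwise by _≈_, so a
-- subset of S_n is a predicate respecting _≈_, and elements of a subset are
-- compared by their underlying permutations, ignoring membership proofs.
record IsSplitting (X : Pred (Permutation′ n) a) (Y : Pred (Permutation′ n) b) :
                   Set (a ⊔ b) where
  field
    X-resp-≈  : X Respects _≈_
    Y-resp-≈  : Y Respects _≈_
    bijective : Bijective (Pointwise (_≈_ on proj₁) (_≈_ on proj₁)) _≈_ (multiply X Y)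
    additive  : ∀ x y → x ∈ X → y ∈ Y → ℓ (x · y) ≡ ℓ x + ℓ y

{-# OPTIONS --safe #-}

-- Let w₀ = x₀y₀ be the factorisation of the longest element.  If w = xy is the
-- factorisation of w, additivity forces, for positions i < j, that y increases
-- from i to j when w does, and that y₀⁻¹y increases from i to j when w
-- decreases.  So y is a common linear extension of two partial orders.
--
-- The top y₀ avoids 2413: restricting a splitting to a parabolic subgroup deletes
-- the least value of y₀, and splittings admit a symmetry turning the diagram of
-- y₀ by a quarter turn, so by induction on n every occurrence uses the extreme
-- values and positions.  Then y₀ = 2 n M 1 (n-1), and the factorisation x y of
-- 1 2 (decreasing) (n-1) n satisfies x y₀ = x₀ y, against uniqueness.
-- Inversion of the splitting turns this into avoidance of 3142.
--
-- For separable y₀ the linear extension is unique: two extensions differ by a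
-- relabelling that never reverses a pair of labels both in value and in y₀-order,
-- and it must fix each block of the recursive decomposition of y₀ into direct and
-- skew sums.  Comparing y with id or with w then places W/Y in X and [e, y₀] in Y.

module Submission where

open import Defs
open import Data.Bool.Base using (if_then_else_; true; false)
open import Data.Empty using (⊥-elim)
open import Data.Fin.Base using (Fin; zero; suc; _<_; opposite; toℕ; fromℕ<; punchOut)
open import Data.Fin.Induction using (<-wellFounded)
open import Data.Fin.Patterns using (0F; 1F; 2F; 3F)
open import Data.Fin.Permutation using
  (Permutation′; inverseˡ; inverseʳ; id; reverse; _≈_; lift₀; lift₀-remove; lift₀-cong; remove; transpose)
  renaming (_⟨$⟩ʳ_ to _⟨_⟩; flip to _⁻¹)
open import Data.Fin.Properties as Fin using
  (_≟_; _<?_; <-cmp; <-trans; <-asym; <-irrefl; opposite-prop; opposite-involutive; pigeonhole;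
   any?; toℕ-fromℕ<; toℕ-injective)
open import Data.List.Base using (_++_; filter; length; tabulate; cartesianProduct; map)
open import Data.List.Properties using (filter-++; length-++; map-tabulate)
open import Data.Nat.Base as ℕ using (ℕ; zero; suc; _+_; s<s; s<s⁻¹; z<s; s≤s; s≤s⁻¹; z≤n)
open import Data.Nat.Properties as ℕ using (+-0-commutativeMonoid)
open import Algebra.Properties.CommutativeMonoid.Sum +-0-commutativeMonoid
  using (sum; sum-cong-≗; ∑-distrib-+; ∑-comm; ∑-permute; sum-syntax)
open import Data.Product.Base using (Σ; ∃; ∃₂; _×_; _,_; proj₁; proj₂)
open import Data.Sum.Base using (_⊎_; inj₁; inj₂; [_,_]′; swap)
open import Function.Base using (_∘_; case_of_; flip)
open import Function.Bundles using (Equivalence)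
open import Induction.WellFounded using (Acc; acc)
open import Level using (Level; _⊔_; 0ℓ) renaming (suc to lsuc)
open import Relation.Binary.Core using (Rel)
open import Relation.Binary.Definitions using (tri<; tri≈; tri>; _Respects_)
open import Relation.Binary.PropositionalEquality
open import Relation.Nullary using (Dec; does; yes; no; ¬_; contradiction)
open import Relation.Nullary.Decidable using (_×-dec_; dec-true; dec-false)
open import Relation.Unary using (Pred; _≐_; Decidable)

private
  variable
    a b p : Level
    A B : Set a
    m n : ℕ

open ≡-Reasoning

-- Lengths as double sums, and length-additivity.

≢⇒<⊎> : ∀ {n} {i j : Fin n} → i ≢ j → i < j ⊎ j < i
≢⇒<⊎> {i = i} {j} i≢j with <-cmp i j
... | tri< i<j _ _ = inj₁ i<j
... | tri≈ _ i≡j _ = contradiction i≡j i≢j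
... | tri> _ _ j<i = inj₂ j<i

⟦_⟧ : Dec A → ℕ
⟦ d ⟧ = if does d then 1 else 0

¬⇒⟦⟧≡0 : (d : Dec A) → ¬ A → ⟦ d ⟧ ≡ 0
¬⇒⟦⟧≡0 (yes a) ¬a = contradiction a ¬a
¬⇒⟦⟧≡0 (no _)  _  = refl

⟦⟧≡0⇒¬ : (d : Dec A) → ⟦ d ⟧ ≡ 0 → ¬ A
⟦⟧≡0⇒¬ (no ¬a) _ = ¬a

⟦⟧-split : {P P′ Q : Set} (P? : Dec P) (P′? : Dec P′) (Q? : Dec Q) →
           (P → ¬ P′) → (¬ P → ¬ P′ → ¬ Q) →
           ⟦ Q? ⟧ ≡ ⟦ P? ×-dec Q? ⟧ + ⟦ P′? ×-dec Q? ⟧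
⟦⟧-split (yes p) (yes p′) Q? excl exh = contradiction p′ (excl p)
⟦⟧-split (yes _) (no _)   Q? excl exh = sym (ℕ.+-identityʳ _)
⟦⟧-split (no _)  (yes _)  Q? excl exh = refl
⟦⟧-split (no ¬p) (no ¬p′) Q? excl exh = ¬⇒⟦⟧≡0 Q? (exh ¬p ¬p′)

-- When `C` holds, both sides are the indicator of `P′` or `Q`.
⟦⟧-trade : {C P P′ Q Q′ : Set}
           (C? : Dec C) (P? : Dec P) (P′? : Dec P′) (Q? : Dec Q) (Q′? : Dec Q′) →
           (C → P ⊎ P′) → (P → ¬ P′) → (C → Q ⊎ Q′) → (Q → ¬ Q′) →
           ⟦ C? ×-dec (P? ×-dec Q?) ⟧ + ⟦ C? ×-dec P′? ⟧ ≡
           ⟦ C? ×-dec Q? ⟧ + ⟦ C? ×-dec (P′? ×-dec Q′?) ⟧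
⟦⟧-trade (no _) _ _ _ _ _ _ _ _ = refl
⟦⟧-trade (yes c) P? P′? Q? Q′? P⊎P′ P⇒¬P′ Q⊎Q′ Q⇒¬Q′ with P⊎P′ c | Q⊎Q′ c
⟦⟧-trade (yes c) (no ¬p) _        _        _         _ _     _ _     | inj₁ p  | _      = contradiction p ¬p
⟦⟧-trade (yes c) (yes p) (yes p′) _        _         _ P⇒¬P′ _ _     | _       | _      = contradiction p′ (P⇒¬P′ p)
⟦⟧-trade (yes c) (yes p) (no _)   (yes _)  _         _ _     _ _     | _       | _      = refl
⟦⟧-trade (yes c) (yes p) (no _)   (no _)   _         _ _     _ _     | _       | _      = refl
⟦⟧-trade (yes c) (no _)  (no ¬p′) _        _         _ _     _ _     | inj₂ p′ | _      = contradiction p′ ¬p′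
⟦⟧-trade (yes c) (no _)  (yes _)  (yes q)  (yes q′)  _ _     _ Q⇒¬Q′ | _       | _      = contradiction q′ (Q⇒¬Q′ q)
⟦⟧-trade (yes c) (no _)  (yes _)  (yes _)  (no _)    _ _     _ _     | _       | _      = refl
⟦⟧-trade (yes c) (no _)  (yes _)  (no _)   (yes _)   _ _     _ _     | _       | _      = refl
⟦⟧-trade (yes c) (no _)  (yes _)  (no ¬q)  (no ¬q′)  _ _     _ _     | _       | q⊎q′   =
  ⊥-elim ([ ¬q , ¬q′ ]′ q⊎q′)

count-tabulate : {P : Pred A p} (P? : Decidable P) (f : Fin n → A) →
                 length (filter P? (tabulate f)) ≡ ∑[ i < n ] ⟦ P? (f i) ⟧
count-tabulate {n = zero}  P? f = refl
count-tabulate {n = suc n} P? f with does (P? (f zero))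
... | true  = cong suc (count-tabulate P? (f ∘ suc))
... | false = count-tabulate P? (f ∘ suc)

count-cartesianProduct :
  {P : Pred (A × B) p} (P? : Decidable P) (f : Fin m → A) (g : Fin n → B) →
  length (filter P? (cartesianProduct (tabulate f) (tabulate g))) ≡
  ∑[ i < m ] ∑[ j < n ] ⟦ P? (f i , g j) ⟧
count-cartesianProduct {m = zero} P? f g = refl
count-cartesianProduct {m = suc m} {n = n} P? f g = begin
  length (filter P? (row ++ rest))
    ≡⟨ cong length (filter-++ P? row rest) ⟩
  length (filter P? row ++ filter P? rest)
    ≡⟨ length-++ (filter P? row) ⟩
  length (filter P? row) + length (filter P? rest)
    ≡⟨ cong₂ _+_ (cong (length ∘ filter P?) (map-tabulate g (f zero ,_)))
                 (count-cartesianProduct P? (f ∘ suc) g) ⟩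
  length (filter P? (tabulate λ j → f zero , g j)) +
  (∑[ i < m ] ∑[ j < n ] ⟦ P? (f (suc i) , g j) ⟧)
    ≡⟨ cong (_+ (∑[ i < m ] ∑[ j < n ] ⟦ P? (f (suc i) , g j) ⟧)) (count-tabulate P? λ j → f zero , g j) ⟩
  _ ∎
  where
  row  = map (f zero ,_) (tabulate g)
  rest = cartesianProduct (tabulate (f ∘ suc)) (tabulate g)

∑∑ : (Fin n → Fin n → ℕ) → ℕ
∑∑ {n} f = ∑[ i < n ] ∑[ j < n ] f i j

∑∑-cong : {f g : Fin n → Fin n → ℕ} → (∀ i j → f i j ≡ g i j) → ∑∑ f ≡ ∑∑ g
∑∑-cong eq = sum-cong-≗ λ i → sum-cong-≗ (eq i)

∑∑-+ : (f g : Fin n → Fin n → ℕ) → ∑∑ (λ i j → f i j + g i j) ≡ ∑∑ f + ∑∑ g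
∑∑-+ f g = trans (sum-cong-≗ λ i → ∑-distrib-+ (f i) (g i)) (∑-distrib-+ (λ i → sum (f i)) (λ i → sum (g i)))

∑∑-permute : (f : Fin n → Fin n → ℕ) (π : Permutation′ n) →
             ∑∑ f ≡ ∑∑ λ i j → f (π ⟨ i ⟩) (π ⟨ j ⟩)
∑∑-permute f π = trans (∑-permute _ π) (sum-cong-≗ λ i → ∑-permute (f (π ⟨ i ⟩)) π)

∑≡0⇒≡0 : (f : Fin n → ℕ) → sum f ≡ 0 → ∀ i → f i ≡ 0
∑≡0⇒≡0 f eq zero    = ℕ.m+n≡0⇒m≡0 (f zero) eq
∑≡0⇒≡0 f eq (suc i) = ∑≡0⇒≡0 (f ∘ suc) (ℕ.m+n≡0⇒n≡0 (f zero) eq) i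

≡0⇒∑≡0 : (f : Fin n → ℕ) → (∀ i → f i ≡ 0) → sum f ≡ 0
≡0⇒∑≡0 {zero}  f eq = refl
≡0⇒∑≡0 {suc n} f eq = cong₂ _+_ (eq zero) (≡0⇒∑≡0 (f ∘ suc) (eq ∘ suc))

ℓ≡∑∑ : (w : Permutation′ n) → ℓ w ≡ ∑∑ λ i j → ⟦ inversion? w (i , j) ⟧
ℓ≡∑∑ w = count-cartesianProduct (inversion? w) (λ i → i) (λ i → i)

ℓ-cong : {v w : Permutation′ n} → v ≈ w → ℓ v ≡ ℓ w
ℓ-cong {v = v} {w} v≈w = trans (ℓ≡∑∑ v) (trans
  (∑∑-cong λ i j → cong₂ (λ c d → ⟦ (i <? j) ×-dec (c <? d) ⟧) (v≈w j) (v≈w i)) (sym (ℓ≡∑∑ w)))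

-- No inversion of v is undone by u; equivalent to ℓ (u · v) ≡ ℓ u + ℓ v.
Reduced : Permutation′ n → Permutation′ n → Set
Reduced u v = ∀ {i j} → i < j → v ⟨ j ⟩ < v ⟨ i ⟩ →
              u ⟨ v ⟨ j ⟩ ⟩ < u ⟨ v ⟨ i ⟩ ⟩

injective : (π : Permutation′ n) {i j : Fin n} → π ⟨ i ⟩ ≡ π ⟨ j ⟩ → i ≡ j
injective π eq = trans (sym (inverseˡ π)) (trans (cong (π ⁻¹ ⟨_⟩) eq) (inverseˡ π))

module Defect (u v : Permutation′ n) where
  v′ uv : Fin n → Fin n
  v′ = v ⟨_⟩
  uv i = u ⟨ v ⟨ i ⟩ ⟩

  -- Reindexing by v, a pair i < j counts in ℓ u as created (an inversion of u · v
  -- but not of v) or as cancelled (the converse), and cancelled pairs count twice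
  -- in ℓ u + ℓ v but not in ℓ (u · v).
  cancelled? : ∀ i j → Dec (i < j × v′ j < v′ i × uv i < uv j)
  cancelled? i j = (i <? j) ×-dec ((v′ j <? v′ i) ×-dec (uv i <? uv j))

  created? : ∀ i j → Dec (i < j × v′ i < v′ j × uv j < uv i)
  created? i j = (i <? j) ×-dec ((v′ i <? v′ j) ×-dec (uv j <? uv i))

  ℓu-summand : ∀ i j → ⟦ inversion? u (v′ i , v′ j) ⟧ ≡ ⟦ created? i j ⟧ + ⟦ cancelled? j i ⟧
  ℓu-summand i j = ⟦⟧-split (i <? j) (j <? i) (inversion? u (v′ i , v′ j)) <-asym neither
    where
    neither : ¬ i < j → ¬ j < i → ¬ Inversion u (v′ i , v′ j)
    neither i≮j j≮i (vi<vj , _) = [ i≮j , j≮i ]′ (≢⇒<⊎> λ { refl → <-irrefl refl vi<vj })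

  trade : ∀ i j → ⟦ created? i j ⟧ + ⟦ inversion? v (i , j) ⟧ ≡
                  ⟦ inversion? (u · v) (i , j) ⟧ + ⟦ cancelled? i j ⟧
  trade i j = ⟦⟧-trade (i <? j) (v′ i <? v′ j) (v′ j <? v′ i) (uv j <? uv i) (uv i <? uv j)
    (λ i<j → ≢⇒<⊎> (Fin.<⇒≢ i<j ∘ injective v)) <-asym
    (λ i<j → ≢⇒<⊎> (Fin.<⇒≢ i<j ∘ sym ∘ injective (u · v))) <-asym

  created cancelled : Fin n → Fin n → ℕ
  created i j   = ⟦ created? i j ⟧
  cancelled i j = ⟦ cancelled? i j ⟧

  inv : Permutation′ n → Fin n → Fin n → ℕ
  inv w i j = ⟦ inversion? w (i , j) ⟧

  defect : ℕ
  defect = ∑∑ cancelled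

  ℓ-defect : ℓ u + ℓ v ≡ ℓ (u · v) + (defect + defect)
  ℓ-defect = begin
    ℓ u + ℓ v
      ≡⟨ cong₂ _+_ (trans (ℓ≡∑∑ u) (∑∑-permute _ v)) (ℓ≡∑∑ v) ⟩
    ∑∑ (λ i j → inv u (v′ i) (v′ j)) + V
      ≡⟨ cong (_+ V) (trans (∑∑-cong ℓu-summand) (∑∑-+ created λ i j → cancelled j i)) ⟩
    (E + ∑∑ λ i j → cancelled j i) + V
      ≡⟨ cong (λ x → (E + x) + V) (∑-comm (λ i j → cancelled j i)) ⟩
    (E + defect) + V
      ≡⟨ ℕ.+-assoc E defect V ⟩
    E + (defect + V)
      ≡⟨ cong (E +_) (ℕ.+-comm defect V) ⟩
    E + (V + defect)
      ≡⟨ ℕ.+-assoc E V defect ⟨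
    (E + V) + defect
      ≡⟨ cong (_+ defect) (trans (sym (∑∑-+ created (inv v)))
                           (trans (∑∑-cong trade) (∑∑-+ (inv (u · v)) cancelled))) ⟩
    (∑∑ (inv (u · v)) + defect) + defect
      ≡⟨ cong (λ x → (x + defect) + defect) (ℓ≡∑∑ (u · v)) ⟨
    (ℓ (u · v) + defect) + defect
      ≡⟨ ℕ.+-assoc (ℓ (u · v)) defect defect ⟩
    ℓ (u · v) + (defect + defect) ∎
    where
    E = ∑∑ created
    V = ∑∑ (inv v)

  reduced⇒additive : Reduced u v → ℓ (u · v) ≡ ℓ u + ℓ v
  reduced⇒additive red = sym (begin
    ℓ u + ℓ v                      ≡⟨ ℓ-defect ⟩
    ℓ (u · v) + (defect + defect)  ≡⟨ cong (λ x → ℓ (u · v) + (x + x)) defect≡0 ⟩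
    ℓ (u · v) + 0                  ≡⟨ ℕ.+-identityʳ _ ⟩
    ℓ (u · v)                      ∎)
    where
    none : ∀ i j → ⟦ cancelled? i j ⟧ ≡ 0
    none i j = ¬⇒⟦⟧≡0 (cancelled? i j)
      λ (i<j , vj<vi , uvi<uvj) → <-asym uvi<uvj (red i<j vj<vi)

    defect≡0 : defect ≡ 0
    defect≡0 = ≡0⇒∑≡0 _ λ i → ≡0⇒∑≡0 _ (none i)

  additive⇒reduced : ℓ (u · v) ≡ ℓ u + ℓ v → Reduced u v
  additive⇒reduced add {i} {j} i<j vj<vi
    with ≢⇒<⊎> (Fin.<⇒≢ i<j ∘ sym ∘ injective (u · v))
  ... | inj₁ uvj<uvi = uvj<uvi
  ... | inj₂ uvi<uvj = contradiction (i<j , vj<vi , uvi<uvj)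
    (⟦⟧≡0⇒¬ (cancelled? i j) (∑≡0⇒≡0 _ (∑≡0⇒≡0 _ defect≡0 i) j))
    where
    defect≡0 : defect ≡ 0
    defect≡0 = ℕ.m+n≡0⇒m≡0 defect (ℕ.+-cancelˡ-≡ (ℓ (u · v)) _ _
      (trans (sym ℓ-defect) (trans (sym add) (sym (ℕ.+-identityʳ _)))))

open Defect public using (reduced⇒additive; additive⇒reduced)

-- Order reversal and monotone permutations.

opposite-anti : {i j : Fin n} → i < j → opposite j < opposite i
opposite-anti {n} {i} {j} i<j = subst₂ ℕ._<_ (sym (opposite-prop j)) (sym (opposite-prop i))
  (ℕ.∸-monoʳ-< {n} (s<s i<j) (Fin.toℕ<n j))

opposite-anti⁻¹ : {i j : Fin n} → opposite j < opposite i → i < j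
opposite-anti⁻¹ {i = i} {j} lt =
  subst₂ _<_ (opposite-involutive i) (opposite-involutive j) (opposite-anti lt)

preimage : (f : Permutation′ n) {i j : Fin n} → f ⟨ i ⟩ ≡ j → i ≡ f ⁻¹ ⟨ j ⟩
preimage f refl = sym (inverseˡ f)

-- Strong induction on `i`. If `f i < i`, then `f i` is already fixed and injectivity fixes `i`. If
-- `i < f i`, the preimage of `i` is smaller (so already fixed), equal, or, against monotonicity,
-- larger.
strictlyMonotoneOn⇒fixed :
  (f : Permutation′ n) (P : Pred (Fin n) p) →
  (∀ {i} → P i → P (f ⟨ i ⟩)) → (∀ {i} → P i → P (f ⁻¹ ⟨ i ⟩)) →
  (∀ {i j} → P i → P j → i < j → f ⟨ i ⟩ < f ⟨ j ⟩) →
  ∀ {i} → P i → f ⟨ i ⟩ ≡ i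
strictlyMonotoneOn⇒fixed f P closed closed⁻¹ mono = go (<-wellFounded _)
  where
  go : ∀ {i} → Acc _<_ i → P i → f ⟨ i ⟩ ≡ i
  go {i} (acc rec) Pi with <-cmp (f ⟨ i ⟩) i
  ... | tri≈ _ e _ = e
  ... | tri< fi<i _ _ = injective f (go (rec fi<i) (closed Pi))
  ... | tri> _ _ i<fi with <-cmp (f ⁻¹ ⟨ i ⟩) i
  ...   | tri< k<i _ _ = trans (sym (cong (f ⟨_⟩) go′)) (inverseʳ f)
    where
    go′ : f ⁻¹ ⟨ i ⟩ ≡ i
    go′ = trans (sym (go (rec k<i) (closed⁻¹ Pi))) (inverseʳ f)
  ...   | tri≈ _ e _ = trans (cong (f ⟨_⟩) (sym e)) (inverseʳ f)
  ...   | tri> _ _ i<k = contradiction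
    (subst (f ⟨ i ⟩ <_) (inverseʳ f) (mono Pi (closed⁻¹ Pi) i<k)) (<-asym i<fi)

strictlyMonotone⇒id : (f : Permutation′ n) → (∀ {i j} → i < j → f ⟨ i ⟩ < f ⟨ j ⟩) → f ≈ id
strictlyMonotone⇒id f mono i =
  strictlyMonotoneOn⇒fixed f (λ j → j ≡ j) (λ _ → refl) (λ _ → refl) (λ _ _ → mono) refl

≮∧≢⇒> : {i j : Fin n} → ¬ i < j → i ≢ j → j < i
≮∧≢⇒> i≮j i≢j = [ (λ i<j → contradiction i<j i≮j) , (λ j<i → j<i) ]′ (≢⇒<⊎> i≢j)

-- Splittings and their symmetries.

-- The factors of the longest element are fields, so that `inverse` and `complement` can prescribe
-- them and the top of `rotate` computes. `unique` compares left factors only; right factors follow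
-- by cancellation.
record Splitting (a b : Level) (n : ℕ) : Set (lsuc (a ⊔ b)) where
  field
    X        : Pred (Permutation′ n) a
    Y        : Pred (Permutation′ n) b
    X-resp   : X Respects _≈_
    Y-resp   : Y Respects _≈_
    factor   : ∀ w → ∃₂ λ x y → X x × Y y × (∀ i → x ⟨ y ⟨ i ⟩ ⟩ ≡ w ⟨ i ⟩)
    unique   : ∀ x x′ y y′ → X x → X x′ → Y y → Y y′ →
               (∀ i → x ⟨ y ⟨ i ⟩ ⟩ ≡ x′ ⟨ y′ ⟨ i ⟩ ⟩) → x ≈ x′
    reduced  : ∀ x y → X x → Y y → Reduced x y
    x₀ y₀    : Permutation′ n
    x₀∈X     : X x₀
    y₀∈Y     : Y y₀
    top      : ∀ i → x₀ ⟨ y₀ ⟨ i ⟩ ⟩ ≡ opposite i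

  x₀-label : ∀ e → x₀ ⟨ e ⟩ ≡ opposite (y₀ ⁻¹ ⟨ e ⟩)
  x₀-label e = trans (cong (x₀ ⟨_⟩) (sym (inverseʳ y₀))) (top (y₀ ⁻¹ ⟨ e ⟩))

  x₀-anti : ∀ {e f} → x₀ ⟨ e ⟩ < x₀ ⟨ f ⟩ → y₀ ⁻¹ ⟨ f ⟩ < y₀ ⁻¹ ⟨ e ⟩
  x₀-anti {e} {f} lt = opposite-anti⁻¹ (subst₂ _<_ (x₀-label e) (x₀-label f) lt)

  -- By reducedness an inversion of `y` would survive in `x · y`, which is the identity.
  id-factors : X id × Y id
  id-factors with factor id
  ... | x , y , x∈X , y∈Y , xy≈id = X-resp x≈id x∈X , Y-resp y≈id y∈Y
    where
    y≈id : y ≈ id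
    y≈id = strictlyMonotone⇒id y λ i<j → ≮∧≢⇒>
      (λ yj<yi → <-asym i<j (subst₂ _<_ (xy≈id _) (xy≈id _) (reduced x y x∈X y∈Y i<j yj<yi)))
      (λ e → Fin.<⇒≢ i<j (sym (injective y e)))
    x≈id : x ≈ id
    x≈id i = trans (cong (x ⟨_⟩) (sym (y≈id i))) (xy≈id i)

  -- Labels `e < f` met by `y₀` in the opposite order form an inversion of `y₀`, which `x` may not
  -- undo.
  X-inversion : ∀ x {e f} → X x → e < f → x ⟨ f ⟩ < x ⟨ e ⟩ → y₀ ⁻¹ ⟨ e ⟩ < y₀ ⁻¹ ⟨ f ⟩
  X-inversion x {e} {f} x∈X e<f xf<xe = ≮∧≢⇒>
    (λ uf<ue → <-asym xf<xe (subst₂ (λ c d → x ⟨ c ⟩ < x ⟨ d ⟩) (inverseʳ y₀) (inverseʳ y₀)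
      (reduced x y₀ x∈X y₀∈Y uf<ue (subst₂ _<_ (sym (inverseʳ y₀)) (sym (inverseʳ y₀)) e<f))))
    (λ eq → Fin.<⇒≢ e<f (sym (injective (y₀ ⁻¹) eq)))

  -- `x₀` keeps every inversion of `y`, and by `top` it orders labels oppositely to `y₀ ⁻¹`.
  Y-inversion : ∀ y {i j} → Y y → i < j → y ⟨ j ⟩ < y ⟨ i ⟩ →
                y₀ ⁻¹ ⟨ y ⟨ i ⟩ ⟩ < y₀ ⁻¹ ⟨ y ⟨ j ⟩ ⟩
  Y-inversion y y∈Y i<j yj<yi = x₀-anti (reduced x₀ y x₀∈X y∈Y i<j yj<yi)

  ascent : ∀ x y {i j} → X x → Y y → i < j → x ⟨ y ⟨ i ⟩ ⟩ < x ⟨ y ⟨ j ⟩ ⟩ → y ⟨ i ⟩ < y ⟨ j ⟩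
  ascent x y x∈X y∈Y i<j lt = ≮∧≢⇒>
    (λ yj<yi → <-asym lt (reduced x y x∈X y∈Y i<j yj<yi))
    (λ eq → Fin.<⇒≢ i<j (sym (injective y eq)))

  -- A descent of `x · y` is either created by `x` on an ascent of `y` or inherited from `y`; both
  -- cases give the same order in `y₀`.
  descent : ∀ x y {i j} → X x → Y y → i < j → x ⟨ y ⟨ j ⟩ ⟩ < x ⟨ y ⟨ i ⟩ ⟩ →
            y₀ ⁻¹ ⟨ y ⟨ i ⟩ ⟩ < y₀ ⁻¹ ⟨ y ⟨ j ⟩ ⟩
  descent x y x∈X y∈Y i<j lt with ≢⇒<⊎> (Fin.<⇒≢ i<j ∘ injective y)
  ... | inj₁ yi<yj = X-inversion x x∈X yi<yj lt
  ... | inj₂ yj<yi = Y-inversion y y∈Y i<j yj<yi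

open Splitting

⁻¹-cong : (v w : Permutation′ n) → v ≈ w → v ⁻¹ ≈ w ⁻¹
⁻¹-cong v w eq i = preimage w (trans (sym (eq _)) (inverseʳ v))

inverse : Splitting a b n → Splitting b a n
inverse {a} {b} {n} S = record
  { X = X′ ; Y = Y′
  ; X-resp = λ {v} {w} eq → Y-resp S (⁻¹-cong v w eq)
  ; Y-resp = λ {v} {w} eq → X-resp S (⁻¹-cong v w eq)
  ; factor = factor′ ; unique = unique′ ; reduced = reduced′
  ; x₀ = y₀ S ⁻¹ ; y₀ = x₀ S ⁻¹ ; x₀∈X = y₀∈Y S ; y₀∈Y = x₀∈X S
  ; top = λ i → sym (preimage (y₀ S) (preimage (x₀ S) (trans (top S _) (opposite-involutive i))))
  }
  where
  X′ : Pred (Permutation′ n) b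
  X′ w = Y S (w ⁻¹)

  Y′ : Pred (Permutation′ n) a
  Y′ w = X S (w ⁻¹)

  factor′ : ∀ w → ∃₂ λ x y → X′ x × Y′ y × (∀ i → x ⟨ y ⟨ i ⟩ ⟩ ≡ w ⟨ i ⟩)
  factor′ w with factor S (w ⁻¹)
  ... | x , y , x∈X , y∈Y , eq = y ⁻¹ , x ⁻¹ , y∈Y , x∈X ,
    λ i → sym (preimage y (preimage x (trans (eq _) (inverseˡ w))))

  unique′ : ∀ x x′ y y′ → X′ x → X′ x′ → Y′ y → Y′ y′ →
            (∀ i → x ⟨ y ⟨ i ⟩ ⟩ ≡ x′ ⟨ y′ ⟨ i ⟩ ⟩) → x ≈ x′
  unique′ x x′ y y′ x∈ x′∈ y∈ y′∈ eq i =
    trans (cong (x ⟨_⟩) (sym (inverseʳ y))) (trans (eq _)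
      (cong (x′ ⟨_⟩) (trans (cong (y′ ⟨_⟩) (y⁻¹≈y′⁻¹ i)) (inverseʳ y′))))
    where
    -- Inversion exchanges the factors, so `unique S` identifies the right ones here; the left ones
    -- follow by cancellation.
    y⁻¹≈y′⁻¹ : y ⁻¹ ≈ y′ ⁻¹
    y⁻¹≈y′⁻¹ = unique S (y ⁻¹) (y′ ⁻¹) (x ⁻¹) (x′ ⁻¹) y∈ y′∈ x∈ x′∈ (⁻¹-cong (x · y) (x′ · y′) eq)

  reduced′ : ∀ x y → X′ x → Y′ y → Reduced x y
  reduced′ x y x∈ y∈ {i} {j} i<j yj<yi = ≮∧≢⇒>
    (λ lt → <-asym i<j (subst₂ _<_
      (trans (cong (y ⁻¹ ⟨_⟩) (inverseˡ x)) (inverseˡ y))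
      (trans (cong (y ⁻¹ ⟨_⟩) (inverseˡ x)) (inverseˡ y))
      (reduced S (y ⁻¹) (x ⁻¹) y∈ x∈ lt (subst₂ _<_ (sym (inverseˡ x)) (sym (inverseˡ x)) yj<yi))))
    (λ e → Fin.<⇒≢ i<j (injective (x · y) e))

-- A factorisation w · w₀ = xy becomes w = (x x₀⁻¹)(x₀ y w₀).
complement : Splitting a b n → Splitting a b n
complement {a} {b} {n} S = record
  { X = X′ ; Y = Y′
  ; X-resp = λ eq → X-resp S λ i → eq _
  ; Y-resp = λ eq → Y-resp S λ i → cong (x₀ S ⁻¹ ⟨_⟩) (eq _)
  ; factor = factor′ ; unique = unique′ ; reduced = reduced′
  ; x₀ = x₀ S ⁻¹ ; y₀ = x₀ S · reverse
  -- Both memberships reduce to those of the identity: `x₀ ⁻¹ · x₀` in `X` and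
  -- `x₀ ⁻¹ · (x₀ · reverse) · reverse` in `Y`.
  ; x₀∈X = X-resp S (λ i → sym (inverseˡ (x₀ S))) (proj₁ (id-factors S))
  ; y₀∈Y = Y-resp S (λ i → sym (trans (inverseˡ (x₀ S)) (opposite-involutive i))) (proj₂ (id-factors S))
  ; top = λ i → inverseˡ (x₀ S)
  }
  where
  X′ : Pred (Permutation′ n) a
  X′ w = X S (w · x₀ S)

  Y′ : Pred (Permutation′ n) b
  Y′ w = Y S (x₀ S ⁻¹ · w · reverse)

  factor′ : ∀ w → ∃₂ λ x y → X′ x × Y′ y × (∀ i → x ⟨ y ⟨ i ⟩ ⟩ ≡ w ⟨ i ⟩)
  factor′ w with factor S (w · reverse)
  ... | x , y , x∈X , y∈Y , eq =
    x · x₀ S ⁻¹ , x₀ S · y · reverse ,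
    X-resp S (λ i → cong (x ⟨_⟩) (sym (inverseˡ (x₀ S)))) x∈X ,
    Y-resp S (λ i → sym (trans (inverseˡ (x₀ S)) (cong (y ⟨_⟩) (opposite-involutive i)))) y∈Y ,
    λ i → trans (cong (x ⟨_⟩) (inverseˡ (x₀ S))) (trans (eq _) (cong (w ⟨_⟩) (opposite-involutive i)))

  unique′ : ∀ x x′ y y′ → X′ x → X′ x′ → Y′ y → Y′ y′ →
            (∀ i → x ⟨ y ⟨ i ⟩ ⟩ ≡ x′ ⟨ y′ ⟨ i ⟩ ⟩) → x ≈ x′
  unique′ x x′ y y′ x∈ x′∈ y∈ y′∈ eq i =
    trans (cong (x ⟨_⟩) (sym (inverseʳ (x₀ S)))) (trans (xx₀≈ _) (cong (x′ ⟨_⟩) (inverseʳ (x₀ S))))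
    where
    xx₀≈ : x · x₀ S ≈ x′ · x₀ S
    xx₀≈ = unique S (x · x₀ S) (x′ · x₀ S) (x₀ S ⁻¹ · y · reverse) (x₀ S ⁻¹ · y′ · reverse)
      x∈ x′∈ y∈ y′∈ λ j →
      trans (cong (x ⟨_⟩) (inverseʳ (x₀ S))) (trans (eq _) (cong (x′ ⟨_⟩) (sym (inverseʳ (x₀ S)))))

  reduced′ : ∀ x y → X′ x → Y′ y → Reduced x y
  reduced′ x y x∈ y∈ {i} {j} i<j yj<yi = subst₂ (λ p q → x ⟨ p ⟩ < x ⟨ q ⟩) x₀e≡yj x₀f≡yi
    -- If `x` undid this inversion, `x · x₀` would invert `e < f`, so `e` would precede `f` in `y₀`;
    -- but `x₀ e < x₀ f` puts `f` first.
    (≮∧≢⇒> (λ xf<xe → <-asym (x₀-anti S x₀e<x₀f) (X-inversion S (x · x₀ S) x∈ e<f xf<xe))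
           (λ eq → Fin.<⇒≢ e<f (sym (injective (x · x₀ S) eq))))
    where
    y″ = x₀ S ⁻¹ · y · reverse
    e = y″ ⟨ opposite j ⟩
    f = y″ ⟨ opposite i ⟩
    x₀e≡yj : x₀ S ⟨ e ⟩ ≡ y ⟨ j ⟩
    x₀e≡yj = trans (inverseʳ (x₀ S)) (cong (y ⟨_⟩) (opposite-involutive j))
    x₀f≡yi : x₀ S ⟨ f ⟩ ≡ y ⟨ i ⟩
    x₀f≡yi = trans (inverseʳ (x₀ S)) (cong (y ⟨_⟩) (opposite-involutive i))
    x₀e<x₀f : x₀ S ⟨ e ⟩ < x₀ S ⟨ f ⟩
    x₀e<x₀f = subst₂ _<_ (sym x₀e≡yj) (sym x₀f≡yi) yj<yi
    e<f : e < f
    e<f = ascent S (x₀ S) y″ (x₀∈X S) y∈ (opposite-anti i<j) x₀e<x₀f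

-- The new top is x₀ = w₀y₀⁻¹, whose diagram is that of y₀ turned by a quarter.
rotate : Splitting a b n → Splitting b a n
rotate S = inverse (complement S)

record Occurrence2413 (y : Permutation′ n) : Set where
  field
    i j k l : Fin n
    i<j : i < j
    j<k : j < k
    k<l : k < l
    yk<yi : y ⟨ k ⟩ < y ⟨ i ⟩
    yi<yl : y ⟨ i ⟩ < y ⟨ l ⟩
    yl<yj : y ⟨ l ⟩ < y ⟨ j ⟩

open Occurrence2413

-- 2413 is invariant under a quarter turn, which permutes its four points cyclically.
rotate-occurrence : (S : Splitting a b n) → Occurrence2413 (y₀ S) → Occurrence2413 (y₀ (rotate S))
rotate-occurrence S o = record
  { i = y₀ S ⟨ k o ⟩ ; j = y₀ S ⟨ i o ⟩ ; k = y₀ S ⟨ l o ⟩ ; l = y₀ S ⟨ j o ⟩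
  ; i<j = yk<yi o ; j<k = yi<yl o ; k<l = yl<yj o
  ; yk<yi = flipped (k<l o) ; yi<yl = flipped (j<k o) ; yl<yj = flipped (i<j o)
  }
  where
  flipped : ∀ {p q} → p < q → x₀ S ⟨ y₀ S ⟨ q ⟩ ⟩ < x₀ S ⟨ y₀ S ⟨ p ⟩ ⟩
  flipped p<q = subst₂ _<_ (sym (top S _)) (sym (top S _)) (opposite-anti p<q)

-- Restriction to the parabolic subgroup fixing `zero`.

lift₀-remove′ : ∀ (w : Permutation′ (suc n)) → w ⟨ zero ⟩ ≡ zero → w ≈ lift₀ (remove zero w)
lift₀-remove′ w eq i = sym (lift₀-remove w eq i)

module Restrict {n : ℕ} (S : Splitting a b (suc n)) where
  -- `lift₀ w` ascends from position `zero` to every other, hence so does `y`; thus `y`, and then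
  -- `x`, fixes `zero`.
  restrict-factor : ∀ w → ∃₂ λ x y → X S (lift₀ x) × Y S (lift₀ y) × (∀ i → x ⟨ y ⟨ i ⟩ ⟩ ≡ w ⟨ i ⟩)
  restrict-factor w with factor S (lift₀ w)
  ... | x , y , x∈X , y∈Y , eq =
    x′ , y′ , X-resp S (lift₀-remove′ x x0≡0) x∈X , Y-resp S (lift₀-remove′ y y0≡0) y∈Y ,
    λ i → Fin.suc-injective (trans (lift₀-remove x x0≡0 (suc (y′ ⟨ i ⟩)))
      (trans (cong (x ⟨_⟩) (lift₀-remove y y0≡0 (suc i))) (eq (suc i))))
    where
    y-least : ∀ {j} → y ⟨ suc j ⟩ ≢ zero
    y-least {j} e = case subst (y ⟨ zero ⟩ <_) e (ascent S x y {zero} {suc j} x∈X y∈Y z<s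
      (subst₂ _<_ (sym (eq zero)) (sym (eq (suc j))) z<s)) of λ ()
    y⁻¹0≡0 : ∀ j → y ⟨ j ⟩ ≡ zero → j ≡ zero
    y⁻¹0≡0 zero    _ = refl
    y⁻¹0≡0 (suc j) e = contradiction e y-least
    y0≡0 : y ⟨ zero ⟩ ≡ zero
    y0≡0 = trans (cong (y ⟨_⟩) (sym (y⁻¹0≡0 (y ⁻¹ ⟨ zero ⟩) (inverseʳ y)))) (inverseʳ y)
    x0≡0 : x ⟨ zero ⟩ ≡ zero
    x0≡0 = trans (cong (x ⟨_⟩) (sym y0≡0)) (eq zero)
    x′ = remove zero x
    y′ = remove zero y

  restrict : Splitting a b n
  restrict = record
    { X = λ w → X S (lift₀ w) ; Y = λ w → Y S (lift₀ w)
    ; X-resp = λ {v} {w} eq → X-resp S (lift₀-cong v w eq)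
    ; Y-resp = λ {v} {w} eq → Y-resp S (lift₀-cong v w eq)
    ; factor = restrict-factor
    ; unique = λ x x′ y y′ x∈ x′∈ y∈ y′∈ eq i → Fin.suc-injective
        (unique S (lift₀ x) (lift₀ x′) (lift₀ y) (lift₀ y′) x∈ x′∈ y∈ y′∈
          (λ { zero → refl ; (suc j) → cong suc (eq j) }) (suc i))
    ; reduced = λ x y x∈ y∈ i<j yj<yi →
        s<s⁻¹ (reduced S (lift₀ x) (lift₀ y) x∈ y∈ (s<s i<j) (s<s yj<yi))
    ; x₀ = proj₁ reverse-factors
    ; y₀ = proj₁ (proj₂ reverse-factors)
    ; x₀∈X = proj₁ (proj₂ (proj₂ reverse-factors))
    ; y₀∈Y = proj₁ (proj₂ (proj₂ (proj₂ reverse-factors)))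
    ; top = proj₂ (proj₂ (proj₂ (proj₂ reverse-factors)))
    }
    where reverse-factors = restrict-factor reverse

  private
    x z : Permutation′ n
    x = x₀ restrict
    z = y₀ restrict

  -- The top of the restriction is y₀ with the value 0 deleted.
  y₀-restrict : ∀ {e f} → y₀ S ⁻¹ ⟨ suc e ⟩ < y₀ S ⁻¹ ⟨ suc f ⟩ → z ⁻¹ ⟨ e ⟩ < z ⁻¹ ⟨ f ⟩
  y₀-restrict {e} {f} ue<uf = ≮∧≢⇒>
    -- `lift₀ x` and `lift₀ z` factor `lift₀ reverse`, in which all pairs of nonzero positions
    -- descend, so `descent` compares `z` with `y₀ S`.
    (λ zf<ze → <-asym ue<uf (subst₂ (λ c d → y₀ S ⁻¹ ⟨ suc c ⟩ < y₀ S ⁻¹ ⟨ suc d ⟩) (inverseʳ z) (inverseʳ z)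
      (descent S (lift₀ x) (lift₀ z) (x₀∈X restrict) (y₀∈Y restrict)
        (s<s zf<ze) (s<s (subst₂ _<_ (sym (top restrict _)) (sym (top restrict _)) (opposite-anti zf<ze))))))
    (λ eq → <-irrefl (cong (λ c → y₀ S ⁻¹ ⟨ suc c ⟩) (sym (injective (z ⁻¹) eq))) ue<uf)

  -- The value at `k` is the least of the four, so if it is not `zero` all four survive the
  -- deletion.
  restrict-occurrence : (o : Occurrence2413 (y₀ S)) → y₀ S ⟨ k o ⟩ ≢ zero → Occurrence2413 z
  restrict-occurrence o yk≢0 = record
    { i = z ⁻¹ ⟨ label (i o) yi≢0 ⟩ ; j = z ⁻¹ ⟨ label (j o) yj≢0 ⟩
    ; k = z ⁻¹ ⟨ label (k o) yk≢0 ⟩ ; l = z ⁻¹ ⟨ label (l o) yl≢0 ⟩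
    ; i<j = positions yi≢0 yj≢0 (i<j o) ; j<k = positions yj≢0 yk≢0 (j<k o)
    ; k<l = positions yk≢0 yl≢0 (k<l o)
    ; yk<yi = labels yk≢0 yi≢0 (yk<yi o) ; yi<yl = labels yi≢0 yl≢0 (yi<yl o)
    ; yl<yj = labels yl≢0 yj≢0 (yl<yj o)
    }
    where
    >⇒≢0 : ∀ {m} {e f : Fin (suc m)} → e < f → f ≢ zero
    >⇒≢0 () refl
    yi≢0 = >⇒≢0 (yk<yi o)
    yl≢0 = >⇒≢0 (yi<yl o)
    yj≢0 = >⇒≢0 (yl<yj o)

    label : ∀ p → y₀ S ⟨ p ⟩ ≢ zero → Fin n
    label p y≢0 = punchOut (y≢0 ∘ sym)
    suc-label : ∀ {p} (y≢0 : y₀ S ⟨ p ⟩ ≢ zero) → suc (label p y≢0) ≡ y₀ S ⟨ p ⟩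
    suc-label y≢0 = Fin.punchIn-punchOut (y≢0 ∘ sym)

    labels : ∀ {p q} (p≢ : y₀ S ⟨ p ⟩ ≢ zero) (q≢ : y₀ S ⟨ q ⟩ ≢ zero) → y₀ S ⟨ p ⟩ < y₀ S ⟨ q ⟩ →
             z ⟨ z ⁻¹ ⟨ label p p≢ ⟩ ⟩ < z ⟨ z ⁻¹ ⟨ label q q≢ ⟩ ⟩
    labels p≢ q≢ lt = subst₂ _<_ (sym (inverseʳ z)) (sym (inverseʳ z))
      (s<s⁻¹ (subst₂ _<_ (sym (suc-label p≢)) (sym (suc-label q≢)) lt))

    positions : ∀ {p q} (p≢ : y₀ S ⟨ p ⟩ ≢ zero) (q≢ : y₀ S ⟨ q ⟩ ≢ zero) → p < q →
                z ⁻¹ ⟨ label p p≢ ⟩ < z ⁻¹ ⟨ label q q≢ ⟩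
    positions p≢ q≢ lt = y₀-restrict (subst₂ _<_
      (preimage (y₀ S) (sym (suc-label p≢))) (preimage (y₀ S) (sym (suc-label q≢))) lt)

open Restrict using (restrict; restrict-occurrence)

-- Avoidance of 2413 by the top.

≢zero⇒> : {e : Fin (suc n)} → e ≢ zero → zero {n} < e
≢zero⇒> {e = zero}  e≢0 = contradiction refl e≢0
≢zero⇒> {e = suc _} _   = z<s

transpose-left : (p q : Fin n) → transpose p q ⟨ p ⟩ ≡ q
transpose-left p q rewrite dec-true (p ≟ p) refl = refl

transpose-right : (p q : Fin n) → transpose p q ⟨ q ⟩ ≡ p
transpose-right p q with q ≟ p
... | yes q≡p = q≡p
... | no  _ rewrite dec-true (q ≟ q) refl = refl

transpose-other : {p q r : Fin n} → r ≢ p → r ≢ q → transpose p q ⟨ r ⟩ ≡ r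
transpose-other {p = p} {q} {r} r≢p r≢q
  rewrite dec-false (r ≟ p) r≢p | dec-false (r ≟ q) r≢q = refl

-- Each fact below about one side of the diagram of y₀ is the preceding one for
-- the rotated splitting.
module Extremal {n : ℕ} (avoids : ∀ {a b} (S : Splitting a b n) → ¬ Occurrence2413 (y₀ S)) where

  yk-least : (S : Splitting a b (suc n)) (o : Occurrence2413 (y₀ S)) → y₀ S ⟨ k o ⟩ ≡ zero
  yk-least S o with y₀ S ⟨ k o ⟩ ≟ zero
  ... | yes yk≡0 = yk≡0
  ... | no  yk≢0 = contradiction (restrict-occurrence S o yk≢0) (avoids (restrict S))

  l-last : (S : Splitting a b (suc n)) (o : Occurrence2413 (y₀ S)) → opposite (l o) ≡ zero
  l-last S o = trans (sym (top S _)) (yk-least (rotate S) (rotate-occurrence S o))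

  yj-greatest : (S : Splitting a b (suc n)) (o : Occurrence2413 (y₀ S)) → opposite (y₀ S ⟨ j o ⟩) ≡ zero
  yj-greatest S o = l-last (rotate S) (rotate-occurrence S o)

  i-first : (S : Splitting a b (suc n)) (o : Occurrence2413 (y₀ S)) → i o ≡ zero
  i-first S o = trans (sym (trans (cong opposite (top S _)) (opposite-involutive _)))
    (yj-greatest (rotate S) (rotate-occurrence S o))

  -- A position `r` in the gap could replace `i` or `j` in the occurrence, according to whether its
  -- value is below or above that of `l`; this contradicts `i-first` or `yj-greatest`.
  gap-ij : (S : Splitting a b (suc n)) (o : Occurrence2413 (y₀ S)) → ∀ {r} → i o < r → ¬ r < j o
  gap-ij S o {r} i<r r<j with <-cmp (y₀ S ⟨ r ⟩) (y₀ S ⟨ l o ⟩)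
  ... | tri< yr<yl _ _ = case subst (i o <_) (i-first S o′) i<r of λ ()
    where
    yr≢0 : y₀ S ⟨ r ⟩ ≢ zero
    yr≢0 e = Fin.<⇒≢ (<-trans r<j (j<k o)) (injective (y₀ S) (trans e (sym (yk-least S o))))
    o′ = record o { i = r ; i<j = r<j ; yi<yl = yr<yl
                  ; yk<yi = subst (_< y₀ S ⟨ r ⟩) (sym (yk-least S o)) (≢zero⇒> yr≢0) }
  ... | tri≈ _ e _ = Fin.<⇒≢ (<-trans r<j (<-trans (j<k o) (k<l o))) (injective (y₀ S) e)
  ... | tri> _ _ yl<yr = Fin.<⇒≢ r<j (injective (reverse · y₀ S)
    (trans (yj-greatest S o′) (sym (yj-greatest S o))))
    where o′ = record o { j = r ; i<j = i<r ; j<k = <-trans r<j (j<k o) ; yl<yj = yl<yr }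

  gap-ki : (S : Splitting a b (suc n)) (o : Occurrence2413 (y₀ S)) →
           ∀ {v} → y₀ S ⟨ k o ⟩ < v → ¬ v < y₀ S ⟨ i o ⟩
  gap-ki S o = gap-ij (rotate S) (rotate-occurrence S o)

  gap-kl : (S : Splitting a b (suc n)) (o : Occurrence2413 (y₀ S)) → ∀ {r} → k o < r → ¬ r < l o
  gap-kl S o {r} k<r r<l = gap-ki (rotate S) (rotate-occurrence S o)
    (subst (_< opposite r) (sym (top S _)) (opposite-anti r<l))
    (subst (opposite r <_) (sym (top S _)) (opposite-anti k<r))

  gap-lj : (S : Splitting a b (suc n)) (o : Occurrence2413 (y₀ S)) →
           ∀ {v} → y₀ S ⟨ l o ⟩ < v → ¬ v < y₀ S ⟨ j o ⟩
  gap-lj S o = gap-kl (rotate S) (rotate-occurrence S o)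

  -- At the positions (i, j, k, l) of the occurrence, y takes the values of y₀ at
  -- (k, i, l, j), and elsewhere it agrees with y₀.
  no-occurrence : (S : Splitting a b (suc n)) → ¬ Occurrence2413 (y₀ S)
  no-occurrence {a} {b} S o with factor S (reverse · (transpose (i o) (l o) · transpose (j o) (k o)))
  -- With `x ≈ x₀`, the label `y î`, equal to `z k̂`, is sent to `opposite l̂` by the factorisation
  -- and to `opposite k̂` by `top`.
  ... | x , y , x∈X , y∈Y , eq = k≢l (injective reverse (trans (sym (top S k̂))
      (trans (cong (x₀ S ⟨_⟩) (sym yi)) (trans (sym (x≈x₀ _)) (trans (eq î) wi)))))
    where
    open Occurrence2413 o using () renaming (i to î; j to ĵ; k to k̂; l to l̂)
    w = reverse · (transpose î l̂ · transpose ĵ k̂)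
    z = y₀ S

    i≢j : î ≢ ĵ
    i≢j = Fin.<⇒≢ (i<j o)
    i≢k : î ≢ k̂
    i≢k = Fin.<⇒≢ (<-trans (i<j o) (j<k o))
    i≢l : î ≢ l̂
    i≢l = Fin.<⇒≢ (<-trans (i<j o) (<-trans (j<k o) (k<l o)))
    j≢k : ĵ ≢ k̂
    j≢k = Fin.<⇒≢ (j<k o)
    j≢l : ĵ ≢ l̂
    j≢l = Fin.<⇒≢ (<-trans (j<k o) (k<l o))
    k≢l : k̂ ≢ l̂
    k≢l = Fin.<⇒≢ (k<l o)

    wi : w ⟨ î ⟩ ≡ opposite l̂
    wi = cong opposite (trans (cong (transpose î l̂ ⟨_⟩) (transpose-other i≢j i≢k))
      (transpose-left î l̂))
    wj : w ⟨ ĵ ⟩ ≡ opposite k̂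
    wj = cong opposite (trans (cong (transpose î l̂ ⟨_⟩) (transpose-left ĵ k̂))
      (transpose-other (i≢k ∘ sym) k≢l))
    wk : w ⟨ k̂ ⟩ ≡ opposite ĵ
    wk = cong opposite (trans (cong (transpose î l̂ ⟨_⟩) (transpose-right ĵ k̂))
      (transpose-other (i≢j ∘ sym) j≢l))
    wl : w ⟨ l̂ ⟩ ≡ opposite î
    wl = cong opposite (trans (cong (transpose î l̂ ⟨_⟩) (transpose-other (j≢l ∘ sym) (k≢l ∘ sym)))
      (transpose-right î l̂))

    Middle : Pred (Fin (suc n)) 0ℓ
    Middle r = r ≢ î × r ≢ ĵ × r ≢ k̂ × r ≢ l̂

    wr : ∀ {r} → Middle r → w ⟨ r ⟩ ≡ opposite r
    wr (r≢i , r≢j , r≢k , r≢l) = cong opposite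
      (trans (cong (transpose î l̂ ⟨_⟩) (transpose-other r≢j r≢k)) (transpose-other r≢i r≢l))

    asc : ∀ {r s} → r < s → w ⟨ r ⟩ < w ⟨ s ⟩ → y ⟨ r ⟩ < y ⟨ s ⟩
    asc r<s wr<ws = ascent S x y x∈X y∈Y r<s (subst₂ _<_ (sym (eq _)) (sym (eq _)) wr<ws)

    above-i : ∀ {r} → r ≢ î → î < r
    above-i {r} r≢i = subst (_< r) (sym (i-first S o)) (≢zero⇒> (r≢i ∘ λ e → trans e (sym (i-first S o))))

    below : ∀ {d e : Fin (suc n)} → opposite d ≡ zero → e ≢ d → e < d
    below {d} {e} d-last e≢d = opposite-anti⁻¹ (subst (_< opposite e) (sym d-last)
      (≢zero⇒> λ e-last → e≢d (injective reverse (trans e-last (sym d-last)))))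

    above-zk : ∀ {e} → e ≢ z ⟨ k̂ ⟩ → z ⟨ k̂ ⟩ < e
    above-zk {e} e≢ = subst (_< e) (sym (yk-least S o)) (≢zero⇒> (e≢ ∘ λ e → trans e (sym (yk-least S o))))

    -- `w` ascends from the first position to all others, so `y î` is the least label. Dually,
    -- `y l̂` is the greatest.
    yi : y ⟨ î ⟩ ≡ z ⟨ k̂ ⟩
    yi with y ⁻¹ ⟨ z ⟨ k̂ ⟩ ⟩ in e
    ... | r with r ≟ î
    ...   | yes refl = sym (preimage (y ⁻¹) e)
    ...   | no  r≢i  = case subst (y ⟨ î ⟩ <_) (trans (sym (preimage (y ⁻¹) e)) (yk-least S o))
                           (asc (above-i r≢i) wi<wr) of λ ()
      where
      wi≡0 : w ⟨ î ⟩ ≡ zero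
      wi≡0 = trans wi (l-last S o)
      wi<wr : w ⟨ î ⟩ < w ⟨ r ⟩
      wi<wr = subst (_< w ⟨ r ⟩) (sym wi≡0) (≢zero⇒> λ wr≡0 → r≢i (injective w (trans wr≡0 (sym wi≡0))))

    yl : y ⟨ l̂ ⟩ ≡ z ⟨ ĵ ⟩
    yl with y ⁻¹ ⟨ z ⟨ ĵ ⟩ ⟩ in e
    ... | r with r ≟ l̂
    ...   | yes refl = sym (preimage (y ⁻¹) e)
    ...   | no  r≢l  = case subst (opposite (y ⟨ l̂ ⟩) <_) (yj-greatest S o) (opposite-anti
                           (subst (_< y ⟨ l̂ ⟩) (sym (preimage (y ⁻¹) e)) (asc (below (l-last S o) r≢l) wr<wl)))
                         of λ ()
      where
      wr<wl : w ⟨ r ⟩ < w ⟨ l̂ ⟩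
      wr<wl = below (trans (cong opposite wl) (trans (opposite-involutive î) (i-first S o))) (r≢l ∘ injective w)

    -- `w` ascends from `ĵ` to every later position, so `y ĵ` is the second least label, which
    -- `gap-ki` identifies as `z î`. The argument for `yk` is dual.
    yj : y ⟨ ĵ ⟩ ≡ z ⟨ î ⟩
    yj with y ⁻¹ ⟨ z ⟨ î ⟩ ⟩ in e
    ... | r with r ≟ ĵ | r ≟ î
    ...   | yes refl | _        = sym (preimage (y ⁻¹) e)
    ...   | no  _    | yes refl = contradiction (injective z (trans (preimage (y ⁻¹) e) yi)) i≢k
    ...   | no  r≢j  | no  r≢i  = contradiction
      (subst (y ⟨ ĵ ⟩ <_) (sym (preimage (y ⁻¹) e)) (asc j<r wj<wr))
      (gap-ki S o (above-zk λ e′ → i≢j (injective y (trans yi (sym e′)))))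
      where
      j<r : ĵ < r
      j<r = ≮∧≢⇒> (gap-ij S o (above-i r≢i)) r≢j
      opp-k< : Dec (r ≡ k̂) → Dec (r ≡ l̂) → opposite k̂ < w ⟨ r ⟩
      opp-k< (yes refl) _          = subst (opposite k̂ <_) (sym wk) (opposite-anti (j<k o))
      opp-k< (no _)     (yes refl) = subst (opposite k̂ <_) (sym wl) (opposite-anti (<-trans (i<j o) (j<k o)))
      opp-k< (no r≢k)   (no r≢l)   = subst (opposite k̂ <_) (sym (wr (r≢i , r≢j , r≢k , r≢l)))
        (opposite-anti (≮∧≢⇒> (λ k<r → gap-kl S o k<r (below (l-last S o) r≢l)) (r≢k ∘ sym)))
      wj<wr : w ⟨ ĵ ⟩ < w ⟨ r ⟩
      wj<wr = subst (_< w ⟨ r ⟩) (sym wj) (opp-k< (r ≟ k̂) (r ≟ l̂))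

    yk : y ⟨ k̂ ⟩ ≡ z ⟨ l̂ ⟩
    yk with y ⁻¹ ⟨ z ⟨ l̂ ⟩ ⟩ in e
    ... | r with r ≟ k̂ | r ≟ l̂
    ...   | yes refl | _        = sym (preimage (y ⁻¹) e)
    ...   | no  _    | yes refl = contradiction (injective z (trans (preimage (y ⁻¹) e) yl)) (j≢l ∘ sym)
    ...   | no  r≢k  | no  r≢l  = contradiction
      (below (yj-greatest S o) λ e′ → k≢l (injective y (trans e′ (sym yl))))
      (gap-lj S o (subst (_< y ⟨ k̂ ⟩) (sym (preimage (y ⁻¹) e)) (asc r<k wr<wk)))
      where
      r<k : r < k̂
      r<k = ≮∧≢⇒> (λ k<r → gap-kl S o k<r (below (l-last S o) r≢l)) (r≢k ∘ sym)
      <opp-j : Dec (r ≡ î) → Dec (r ≡ ĵ) → w ⟨ r ⟩ < opposite ĵ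
      <opp-j (yes refl) _          = subst (_< opposite ĵ) (sym wi) (opposite-anti (<-trans (j<k o) (k<l o)))
      <opp-j (no _)     (yes refl) = subst (_< opposite ĵ) (sym wj) (opposite-anti (j<k o))
      <opp-j (no r≢i)   (no r≢j)   = subst (_< opposite ĵ) (sym (wr (r≢i , r≢j , r≢k , r≢l)))
        (opposite-anti (≮∧≢⇒> (gap-ij S o (above-i r≢i)) r≢j))
      wr<wk : w ⟨ r ⟩ < w ⟨ k̂ ⟩
      wr<wk = subst (w ⟨ r ⟩ <_) (sym wk) (<opp-j (r ≟ î) (r ≟ ĵ))

    -- `y` and `z` use the same labels at the four special positions, so `z ⁻¹ · y` preserves the
    -- middle; `w` decreases there, so `descent` makes this map increasing, hence trivial.
    yr : ∀ {r} → Middle r → y ⟨ r ⟩ ≡ z ⟨ r ⟩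
    yr {r} mid = trans (preimage (z ⁻¹) (strictlyMonotoneOn⇒fixed (z ⁻¹ · y) Middle
      (λ (r≢i , r≢j , r≢k , r≢l) → avoid r≢j yj , avoid r≢l yl , avoid r≢i yi , avoid r≢k yk)
      (λ (r≢i , r≢j , r≢k , r≢l) → avoid⁻¹ r≢k yi , avoid⁻¹ r≢i yj , avoid⁻¹ r≢l yk , avoid⁻¹ r≢j yl)
      (λ midr mids r<s → descent S x y x∈X y∈Y r<s (subst₂ _<_
        (sym (trans (eq _) (wr mids))) (sym (trans (eq _) (wr midr))) (opposite-anti r<s)))
      mid)) refl
      where
      avoid : ∀ {r p q} → r ≢ p → y ⟨ p ⟩ ≡ z ⟨ q ⟩ → z ⁻¹ ⟨ y ⟨ r ⟩ ⟩ ≢ q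
      avoid r≢p yp≡zq e = r≢p (injective y (trans (preimage (z ⁻¹) e) (sym yp≡zq)))
      avoid⁻¹ : ∀ {r p q} → r ≢ q → y ⟨ p ⟩ ≡ z ⟨ q ⟩ → y ⁻¹ ⟨ z ⟨ r ⟩ ⟩ ≢ p
      avoid⁻¹ r≢q yp≡zq e = r≢q (injective z (trans (preimage (y ⁻¹) e) yp≡zq))

    swapped : ∀ {r s t} → z ⟨ r ⟩ ≡ y ⟨ s ⟩ → w ⟨ s ⟩ ≡ opposite t → y ⟨ r ⟩ ≡ z ⟨ t ⟩ →
              x ⟨ z ⟨ r ⟩ ⟩ ≡ x₀ S ⟨ y ⟨ r ⟩ ⟩
    swapped zr≡ys ws≡ yr≡zt = trans (cong (x ⟨_⟩) zr≡ys) (trans (eq _) (trans ws≡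
      (sym (trans (cong (x₀ S ⟨_⟩) yr≡zt) (top S _)))))

    xz≈x₀y : ∀ r → x ⟨ z ⟨ r ⟩ ⟩ ≡ x₀ S ⟨ y ⟨ r ⟩ ⟩
    xz≈x₀y r with r ≟ î | r ≟ ĵ | r ≟ k̂ | r ≟ l̂
    ... | yes refl | _        | _        | _        = swapped (sym yj) wj yi
    ... | no _     | yes refl | _        | _        = swapped (sym yl) wl yj
    ... | no _     | no _     | yes refl | _        = swapped (sym yi) wi yk
    ... | no _     | no _     | no _     | yes refl = swapped (sym yk) wk yl
    ... | no r≢i   | no r≢j   | no r≢k   | no r≢l   = swapped (sym (yr mid)) (wr mid) (yr mid)
      where
      mid : Middle r
      mid = r≢i , r≢j , r≢k , r≢l

    x≈x₀ : x ≈ x₀ S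
    x≈x₀ = unique S x (x₀ S) z y x∈X (x₀∈X S) (y₀∈Y S) y∈Y xz≈x₀y

top-avoids-2413 : ∀ n → (S : Splitting a b n) → ¬ Occurrence2413 (y₀ S)
top-avoids-2413 zero    S o = case i o of λ ()
top-avoids-2413 (suc n) S o = Extremal.no-occurrence (top-avoids-2413 n) S o

-- Closed sets of a permutation of a finite set.

module _ (f : Permutation′ n) where

  iterate : ℕ → Fin n → Fin n
  iterate zero    i = i
  iterate (suc t) i = f ⟨ iterate t i ⟩

  recurrent : ∀ s t i → s ℕ.< t → iterate s i ≡ iterate t i → ∃ λ r → i ≡ iterate (suc r) i
  recurrent zero    (suc t) i _   eq = t , eq
  recurrent (suc s) (suc t) i s<t eq = recurrent s t i (s<s⁻¹ s<t) (injective f eq)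

  -- By pigeonhole the orbit of `i` returns to `i`, so closure carries `P` from `f i` all the way
  -- round.
  closed⇒reflects : {P : Pred (Fin n) p} → (∀ {i} → P i → P (f ⟨ i ⟩)) → ∀ {i} → P (f ⟨ i ⟩) → P i
  closed⇒reflects {P = P} closed {i} Pfi
    with pigeonhole (ℕ.n<1+n n) (λ t → iterate (toℕ t) i)
  ... | s , t , s<t , eq with recurrent (toℕ s) (toℕ t) i s<t eq
  ...   | r , i≡ = subst P (sym i≡) (orbit r)
    where
    orbit : ∀ t → P (iterate (suc t) i)
    orbit zero    = Pfi
    orbit (suc t) = closed (orbit t)

-- Direct and skew sum decompositions of separable orders.

Between : ℕ → ℕ → Fin n → Set
Between lo hi e = lo ℕ.≤ toℕ e × toℕ e ℕ.< hi

-- A decomposition of the labels in `[lo, hi)` as a direct sum; for the flipped relation, as a skew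
-- sum.
Cut : Rel (Fin n) 0ℓ → ℕ → ℕ → ℕ → Set
Cut _≺_ lo mid hi = lo ℕ.< mid × mid ℕ.< hi ×
  (∀ {e f} → Between lo mid e → Between mid hi f → e ≺ f)

-- The second component says that the first block cannot be cut again in the same
-- direction; it is the invariant of the induction on hi.
MinimalCut : Rel (Fin n) 0ℓ → ℕ → ℕ → Set
MinimalCut _≺_ lo hi = ∃ λ mid → Cut _≺_ lo mid hi ×
  (mid ≡ suc lo ⊎ ∃ λ mid′ → Cut (flip _≺_) lo mid′ mid)

-- For e ≺ f given by u e < u f, an occurrence of 3142 in u; for the opposite
-- relation, one of 2413.
Avoids3142 : Rel (Fin n) 0ℓ → Set
Avoids3142 _≺_ = ∀ {e f g h} → e < f → f < g → g < h → f ≺ h → h ≺ e → ¬ e ≺ g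

-- A second linear order on labels, instead of a permutation, lets `opposite-order` exchange direct
-- and skew sums, so each argument is made once.
record SeparableOrder (n : ℕ) : Set₁ where
  infix 4 _≺_
  field
    _≺_   : Rel (Fin n) 0ℓ
    _≺?_  : ∀ e f → Dec (e ≺ f)
    trans≺ : ∀ {e f g} → e ≺ f → f ≺ g → e ≺ g
    asym≺ : ∀ {e f} → e ≺ f → ¬ f ≺ e
    total≺ : ∀ {e f} → e ≢ f → e ≺ f ⊎ f ≺ e
    avoids : Avoids3142 _≺_
    avoids′ : Avoids3142 (flip _≺_)

opposite-order : SeparableOrder n → SeparableOrder n
opposite-order O = record
  { _≺_ = flip _≺_ ; _≺?_ = flip _≺?_ ; trans≺ = flip trans≺ ; asym≺ = asym≺
  ; total≺ = λ e≢f → total≺ (e≢f ∘ sym)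
  ; avoids = avoids′ ; avoids′ = avoids }
  where open SeparableOrder O

module _ (O : SeparableOrder n) where
  open SeparableOrder O

  -- A new last label z above the first block keeps the cut, one below it creates
  -- the opposite cut, and one in the middle of it completes an occurrence of 3142.
  extend : ∀ {lo} (z : Fin n) → MinimalCut _≺_ lo (toℕ z) →
           MinimalCut _≺_ lo (suc (toℕ z)) ⊎ MinimalCut (flip _≺_) lo (suc (toℕ z))
  extend {lo} z (mid , (lo<mid , mid<z , cut) , minimal)
    with any? (λ e → (lo ℕ.≤? toℕ e ×-dec toℕ e ℕ.<? mid) ×-dec (z ≺? e))
       | any? (λ e → (lo ℕ.≤? toℕ e ×-dec toℕ e ℕ.<? mid) ×-dec (e ≺? z))
  ... | no z⊀ | _ = inj₁ (mid , (lo<mid , ℕ.m<n⇒m<1+n mid<z , cut′) , minimal)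
    where
    cut′ : ∀ {e f} → Between lo mid e → Between mid (suc (toℕ z)) f → e ≺ f
    cut′ {e} {f} e∈ (mid≤f , f≤z) with f ≟ z
    ... | no  f≢z  = cut e∈ (mid≤f , ℕ.≤∧≢⇒< (s≤s⁻¹ f≤z) (f≢z ∘ toℕ-injective))
    ... | yes refl = [ (λ e≺z → e≺z) , (λ z≺e → contradiction (e , e∈ , z≺e) z⊀) ]′
                       (total≺ λ { refl → ℕ.<-irrefl refl (ℕ.<-trans (proj₂ e∈) mid<z) })
  ... | yes (e₁ , e₁∈ , z≺e₁) | no ⊀z =
    inj₂ (toℕ z , (ℕ.<-trans lo<mid mid<z , ℕ.n<1+n _ , cut′) , inj₂ (mid , lo<mid , mid<z , cut))
    where
    below-z : ∀ {e} → Between lo (toℕ z) e → z ≺ e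
    below-z {e} (lo≤e , e<z) with toℕ e ℕ.<? mid
    ... | no  e≮mid = trans≺ z≺e₁ (cut e₁∈ (ℕ.≮⇒≥ e≮mid , e<z))
    ... | yes e<mid = [ (λ z≺e → z≺e) , (λ e≺z → contradiction (e , (lo≤e , e<mid) , e≺z) ⊀z) ]′
                        (total≺ λ { refl → ℕ.<-irrefl refl e<z })
    cut′ : ∀ {e f} → Between lo (toℕ z) e → Between (toℕ z) (suc (toℕ z)) f → f ≺ e
    cut′ {f = f} e∈ (z≤f , f≤z) with toℕ-injective {i = z} {f} (ℕ.≤-antisym z≤f (s≤s⁻¹ f≤z))
    ... | refl = below-z e∈
  ... | yes (e₁ , (lo≤e₁ , e₁<mid) , z≺e₁) | yes (e₂ , (lo≤e₂ , e₂<mid) , e₂≺z) with minimal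
  -- A one-label first block forces `e₁` and `e₂` to coincide.
  ...   | inj₁ refl with toℕ-injective {i = e₁} {e₂} (trans (sym (ℕ.≤-antisym lo≤e₁ (s≤s⁻¹ e₁<mid)))
                                           (ℕ.≤-antisym lo≤e₂ (s≤s⁻¹ e₂<mid)))
  ...     | refl = contradiction e₂≺z (asym≺ z≺e₁)
  extend {lo} z (mid , (lo<mid , mid<z , cut) , minimal)
      | yes (e₁ , (lo≤e₁ , e₁<mid) , z≺e₁) | yes (e₂ , (lo≤e₂ , e₂<mid) , e₂≺z)
        | inj₂ (mid′ , lo<mid′ , mid′<mid , cut′) = contradiction
    (cut (proj₁ hi∈ , ℕ.<-trans (proj₂ hi∈) mid′<mid) g∈)
    -- The occurrence is `high`, `low`, the label `mid` and `z`, with `low ≺ z ≺ high`, and `cut`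
    -- puts `high` before `mid`.
    (avoids (ℕ.<-≤-trans (proj₂ hi∈) (proj₁ lo∈)) (ℕ.<-≤-trans (proj₂ lo∈) (proj₁ g∈)) (proj₂ g∈)
            (proj₂ (proj₂ low)) (proj₂ (proj₂ high)))
    where
    at : ∀ t → t ℕ.< toℕ z → ∃ λ (e : Fin n) → toℕ e ≡ t
    at t t<z = fromℕ< (ℕ.<-trans t<z (Fin.toℕ<n z)) , toℕ-fromℕ< _

    between : ∀ {r s t} (t<z : t ℕ.< toℕ z) → r ℕ.≤ t → t ℕ.< s → Between r s (proj₁ (at t t<z))
    between t<z r≤t t<s =
      subst (_ ℕ.≤_) (sym (proj₂ (at _ t<z))) r≤t , subst (ℕ._< _) (sym (proj₂ (at _ t<z))) t<s

    mid′<z = ℕ.<-trans mid′<mid mid<z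
    lo<z   = ℕ.<-trans lo<mid mid<z

    -- A witness in the wrong half of the first block is replaced, through the opposite cut, by the
    -- label `mid′`, or by `lo` for `high`.
    low : ∃ λ e → Between mid′ mid e × e ≺ z
    low with toℕ e₂ ℕ.<? mid′
    ... | no  e₂≮mid′ = e₂ , (ℕ.≮⇒≥ e₂≮mid′ , e₂<mid) , e₂≺z
    ... | yes e₂<mid′ = _ , between mid′<z ℕ.≤-refl mid′<mid ,
      trans≺ (cut′ (lo≤e₂ , e₂<mid′) (between mid′<z ℕ.≤-refl mid′<mid)) e₂≺z

    high : ∃ λ e → Between lo mid′ e × z ≺ e
    high with toℕ e₁ ℕ.<? mid′
    ... | yes e₁<mid′ = e₁ , (lo≤e₁ , e₁<mid′) , z≺e₁
    ... | no  e₁≮mid′ = _ , between lo<z ℕ.≤-refl lo<mid′ ,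
      trans≺ z≺e₁ (cut′ (between lo<z ℕ.≤-refl lo<mid′) (ℕ.≮⇒≥ e₁≮mid′ , e₁<mid))

    hi∈ = proj₁ (proj₂ high)
    lo∈ = proj₁ (proj₂ low)
    g∈ : Between mid (toℕ z) (proj₁ (at mid mid<z))
    g∈ = between mid<z ℕ.≤-refl mid<z

-- Labels are added one at a time by `extend`, starting from two. The interval has `d + 2` labels;
-- the form of its upper end makes adding a label a successor step.
minimalCut : (O : SeparableOrder n) → ∀ lo d → suc d + suc lo ℕ.≤ n →
             let open SeparableOrder O in
             MinimalCut _≺_ lo (suc d + suc lo) ⊎ MinimalCut (flip _≺_) lo (suc d + suc lo)
minimalCut {n} O lo zero lt = [ inj₁ ∘ single O , inj₂ ∘ single (opposite-order O) ]′ (total≺ e≢f)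
  where
  open SeparableOrder O
  e f : Fin n
  e = fromℕ< (ℕ.<-trans (ℕ.n<1+n lo) lt)
  f = fromℕ< lt
  e≡ : toℕ e ≡ lo
  e≡ = toℕ-fromℕ< _
  f≡ : toℕ f ≡ suc lo
  f≡ = toℕ-fromℕ< _
  e≢f : e ≢ f
  e≢f eq = ℕ.<⇒≢ (ℕ.n<1+n lo) (trans (sym e≡) (trans (cong toℕ eq) f≡))
  single : (O : SeparableOrder n) → let open SeparableOrder O renaming (_≺_ to _≺′_) in e ≺′ f → MinimalCut _≺′_ lo (suc (suc lo))
  single O e≺f = suc lo , (ℕ.n<1+n lo , ℕ.n<1+n _ , λ (lo≤e′ , e′<) (lo≤f′ , f′<) → subst₂ (SeparableOrder._≺_ O)
    (toℕ-injective (trans e≡ (ℕ.≤-antisym lo≤e′ (s≤s⁻¹ e′<))))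
    (toℕ-injective (trans f≡ (ℕ.≤-antisym lo≤f′ (s≤s⁻¹ f′<)))) e≺f) , inj₁ refl
minimalCut {n} O lo (suc d) lt with minimalCut O lo d (ℕ.<⇒≤ lt)
... | c = subst (λ hi → MinimalCut _≺_ lo (suc hi) ⊎ MinimalCut (flip _≺_) lo (suc hi)) z≡
  ([ (λ c → extend O z (subst (MinimalCut _≺_ lo) (sym z≡) c)) ,
    (λ c → swap (extend (opposite-order O) z (subst (MinimalCut (flip _≺_) lo) (sym z≡) c))) ]′ c)
  where
  open SeparableOrder O
  z : Fin n
  z = fromℕ< lt
  z≡ : toℕ z ≡ suc d + suc lo
  z≡ = toℕ-fromℕ< lt

-- Rigidity of separable orders.

Preserves : Permutation′ n → Rel (Fin n) 0ℓ → Set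
Preserves g R = ∀ {e f} → e < f → g ⟨ f ⟩ < g ⟨ e ⟩ → R e f → R (g ⟨ e ⟩) (g ⟨ f ⟩)

Closed : Permutation′ n → ℕ → ℕ → Set
Closed g lo hi = ∀ {e} → Between lo hi e → Between lo hi (g ⟨ e ⟩)

module _ (O : SeparableOrder n) (g : Permutation′ n) where
  open SeparableOrder O

  -- If some `e` moved up across the cut, no `f` could move down: the pair would be reversed in
  -- value, so `pres` would keep `e ≺ f`, against the cut at the images. The upper block would then
  -- be closed, so by `closed⇒reflects` it would contain `e`.
  cut-closed : Preserves g _≺_ → ∀ {lo mid hi} → Cut _≺_ lo mid hi → Closed g lo hi →
               Closed g lo mid × Closed g mid hi
  cut-closed pres {lo} {mid} {hi} (lo<mid , mid<hi , cut) closed = lower , upper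
    where
    upper-closed : (∀ {f} → Between mid hi f → ¬ Between lo mid (g ⟨ f ⟩)) → Closed g mid hi
    upper-closed stays {f} f∈@(mid≤f , f<hi)
      with toℕ (g ⟨ f ⟩) ℕ.<? mid | closed (ℕ.≤-trans (ℕ.<⇒≤ lo<mid) mid≤f , f<hi)
    ... | no  gf≮mid | _ , gf<hi = ℕ.≮⇒≥ gf≮mid , gf<hi
    ... | yes gf<mid | lo≤gf , _ = contradiction (lo≤gf , gf<mid) (stays f∈)

    lower : Closed g lo mid
    lower {e} e∈@(lo≤e , e<mid) with toℕ (g ⟨ e ⟩) ℕ.<? mid | closed (lo≤e , ℕ.<-trans e<mid mid<hi)
    ... | yes ge<mid | lo≤ge , _ = lo≤ge , ge<mid
    ... | no  ge≮mid | _ , ge<hi = contradiction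
      (proj₁ (closed⇒reflects g {P = Between mid hi} (upper-closed reversed) ge∈)) (ℕ.<⇒≱ e<mid)
      where
      ge∈ : Between mid hi (g ⟨ e ⟩)
      ge∈ = ℕ.≮⇒≥ ge≮mid , ge<hi
      reversed : ∀ {f} → Between mid hi f → ¬ Between lo mid (g ⟨ f ⟩)
      reversed f∈ gf∈ = asym≺ (cut gf∈ ge∈)
        (pres (ℕ.<-≤-trans e<mid (proj₁ f∈)) (ℕ.<-≤-trans (proj₂ gf∈) (proj₁ ge∈)) (cut e∈ f∈))

    upper : Closed g mid hi
    upper = upper-closed λ f∈ gf∈ →
      ℕ.<⇒≱ (proj₂ (closed⇒reflects g {P = Between lo mid} lower gf∈)) (proj₁ f∈)

preserving⇒id : (O : SeparableOrder n) (g : Permutation′ n) → let open SeparableOrder O in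
                Preserves g _≺_ → Preserves g (flip _≺_) → g ≈ id
preserving⇒id {n} O g pres pres′ e =
  fixed n 0 n ℕ.≤-refl ℕ.≤-refl (λ _ → z≤n , Fin.toℕ<n _) (z≤n , Fin.toℕ<n e)
  where
  open SeparableOrder O

  -- `size` bounds `hi - lo`; both blocks of a cut are shorter, so the recursion is structural.
  fixed : ∀ size lo hi → hi ℕ.≤ lo + size → hi ℕ.≤ n → Closed g lo hi → ∀ {e} → Between lo hi e → g ⟨ e ⟩ ≡ e
  fixed zero lo hi hi≤ _ _ {e} (lo≤e , e<hi) =
    contradiction (ℕ.<-≤-trans e<hi (ℕ.≤-trans hi≤ (ℕ.≤-reflexive (ℕ.+-identityʳ lo)))) (ℕ.≤⇒≯ lo≤e)
  fixed (suc size) lo hi hi≤ hi≤n closed {e} e∈@(lo≤e , e<hi) with ℕ.m≤n⇒∃[o]m+o≡n (ℕ.≤-<-trans lo≤e e<hi)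
  ... | zero , refl = toℕ-injective (trans (squeeze (closed e∈)) (sym (squeeze e∈)))
    where
    squeeze : ∀ {f : Fin n} → Between lo (suc (lo + 0)) f → toℕ f ≡ lo
    squeeze (lo≤f , f<) = ℕ.≤-antisym (ℕ.≤-trans (s≤s⁻¹ f<) (ℕ.≤-reflexive (ℕ.+-identityʳ lo))) lo≤f
  ... | suc d , refl = [ (λ (mid , c , _) → by-cut c (cut-closed O g pres c closed)) ,
                         (λ (mid , c , _) → by-cut c (cut-closed (opposite-order O) g pres′ c closed)) ]′
                       (subst (λ h → MinimalCut _≺_ lo h ⊎ MinimalCut (flip _≺_) lo h) hi≡
                         (minimalCut O lo d (subst (ℕ._≤ n) (sym hi≡) hi≤n)))
    where
    hi≡ : suc d + suc lo ≡ suc (lo + suc d)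
    hi≡ = ℕ.+-comm (suc d) (suc lo)
    by-cut : ∀ {R : Rel (Fin n) 0ℓ} {mid} → Cut R lo mid hi → Closed g lo mid × Closed g mid hi → g ⟨ e ⟩ ≡ e
    by-cut {mid = mid} (lo<mid , mid<hi , _) (lower , upper) with toℕ e ℕ.<? mid
    ... | yes e<mid = fixed size lo mid
                        (s≤s⁻¹ (ℕ.≤-trans mid<hi (ℕ.≤-trans hi≤ (ℕ.≤-reflexive (ℕ.+-suc lo size)))))
                        (ℕ.≤-trans (ℕ.<⇒≤ mid<hi) hi≤n) lower (lo≤e , e<mid)
    ... | no  e≮mid = fixed size mid hi
                        (ℕ.≤-trans hi≤ (ℕ.≤-trans (ℕ.≤-reflexive (ℕ.+-suc lo size)) (ℕ.+-monoˡ-≤ size lo<mid)))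
                        hi≤n upper (ℕ.≮⇒≥ e≮mid , e<hi)

-- Separability of the top and uniqueness of labellings.

-- The top of `inverse S` is `x₀ ⁻¹`, that is `y₀` read backwards, and 3142 backwards is 2413.
top-avoids-3142 : (S : Splitting a b n) → ∀ {i j k l} → i < j → j < k → k < l →
  let y = y₀ S in y ⟨ j ⟩ < y ⟨ l ⟩ → y ⟨ l ⟩ < y ⟨ i ⟩ → ¬ y ⟨ i ⟩ < y ⟨ k ⟩
top-avoids-3142 S {i} {j} {k} {l} i<j j<k k<l yj<yl yl<yi yi<yk = top-avoids-2413 _ (inverse S) record
  { i = opposite l ; j = opposite k ; k = opposite j ; l = opposite i
  ; i<j = opposite-anti k<l ; j<k = opposite-anti j<k ; k<l = opposite-anti i<j
  ; yk<yi = reversed yj<yl ; yi<yl = reversed yl<yi ; yl<yj = reversed yi<yk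
  }
  where
  reversed : ∀ {p q} → y₀ S ⟨ p ⟩ < y₀ S ⟨ q ⟩ → y₀ (inverse S) ⟨ opposite p ⟩ < y₀ (inverse S) ⟨ opposite q ⟩
  reversed = subst₂ _<_ (preimage (x₀ S) (top S _)) (preimage (x₀ S) (top S _))

top-separable : (S : Splitting a b n) → Separable (y₀ S)
top-separable S =
  (λ (f , mono , pat) → top-avoids-3142 S (mono 0<1) (mono 1<2) (mono 2<3)
    (Equivalence.to (pat 1F 3F) (s≤s (s≤s z≤n)))
    (Equivalence.to (pat 3F 0F) (s≤s (s≤s (s≤s z≤n))))
    (Equivalence.to (pat 0F 2F) (s≤s (s≤s (s≤s (s≤s z≤n)))))) ,
  (λ (f , mono , pat) → top-avoids-2413 _ S record
    { i<j = mono 0<1 ; j<k = mono 1<2 ; k<l = mono 2<3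
    ; yk<yi = Equivalence.to (pat 2F 0F) (s≤s (s≤s z≤n))
    ; yi<yl = Equivalence.to (pat 0F 3F) (s≤s (s≤s (s≤s z≤n)))
    ; yl<yj = Equivalence.to (pat 3F 1F) (s≤s (s≤s (s≤s (s≤s z≤n)))) })
  where
  0<1 : _<_ {4} {4} 0F 1F
  0<1 = s≤s z≤n
  1<2 : _<_ {4} {4} 1F 2F
  1<2 = s≤s (s≤s z≤n)
  2<3 : _<_ {4} {4} 2F 3F
  2<3 = s≤s (s≤s (s≤s z≤n))

-- Labels are ordered by position in `y₀`. The patterns 3142 and 2413 are inverse to each other, so
-- the two avoidance results trade places.
topOrder : Splitting a b n → SeparableOrder n
topOrder S = record
  { _≺_ = λ e f → u ⟨ e ⟩ < u ⟨ f ⟩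
  ; _≺?_ = λ e f → u ⟨ e ⟩ <? u ⟨ f ⟩
  ; trans≺ = <-trans
  ; asym≺ = <-asym
  ; total≺ = λ e≢f → ≢⇒<⊎> (e≢f ∘ injective u)
  ; avoids = λ e<f f<g g<h uf<uh uh<ue ue<ug → top-avoids-2413 _ S record
      { i<j = uf<uh ; j<k = uh<ue ; k<l = ue<ug
      ; yk<yi = labels e<f ; yi<yl = labels f<g ; yl<yj = labels g<h }
  ; avoids′ = λ e<f f<g g<h uh<uf ue<uh ug<ue →
      top-avoids-3142 S ug<ue ue<uh uh<uf (labels e<f) (labels f<g) (labels g<h)
  }
  where
  u = y₀ S ⁻¹
  labels : ∀ {e f} → e < f → y₀ S ⟨ u ⟨ e ⟩ ⟩ < y₀ S ⟨ u ⟨ f ⟩ ⟩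
  labels = subst₂ _<_ (sym (inverseʳ (y₀ S))) (sym (inverseʳ (y₀ S)))

-- The constraints on the right factor v of w; they only involve w and y₀, so they
-- also make sense when v is not in Y.
record Labelling (S : Splitting a b n) (w v : Permutation′ n) : Set where
  field
    on-ascent  : ∀ {i j} → i < j → w ⟨ i ⟩ < w ⟨ j ⟩ → v ⟨ i ⟩ < v ⟨ j ⟩
    on-descent : ∀ {i j} → i < j → w ⟨ j ⟩ < w ⟨ i ⟩ →
                 y₀ S ⁻¹ ⟨ v ⟨ i ⟩ ⟩ < y₀ S ⁻¹ ⟨ v ⟨ j ⟩ ⟩

open Labelling

factor-labelling : (S : Splitting a b n) {w x y : Permutation′ n} → X S x → Y S y →
                   (∀ i → x ⟨ y ⟨ i ⟩ ⟩ ≡ w ⟨ i ⟩) → Labelling S w y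
factor-labelling S {w} {x} {y} x∈X y∈Y eq = record
  { on-ascent  = λ i<j → ascent S x y x∈X y∈Y i<j ∘ subst₂ _<_ (sym (eq _)) (sym (eq _))
  ; on-descent = λ i<j → descent S x y x∈X y∈Y i<j ∘ subst₂ _<_ (sym (eq _)) (sym (eq _)) }

-- Let `g = y · v ⁻¹` reverse two labels in value. Then `v` and `y` order them differently, so `w`
-- cannot ascend at their positions; it descends, and both labellings give the same order in `y₀`.
-- Hence `g` is trivial by rigidity.
labelling-unique : (S : Splitting a b n) (w v y : Permutation′ n) →
                   Labelling S w v → Labelling S w y → y ≈ v
labelling-unique {n = n} S w v y V Y i =
  trans (cong (y ⟨_⟩) (sym (inverseˡ v))) (preserving⇒id O g
    (λ e<f gf<ge e≺f → [ proj₂ , (λ (f≺e , _) → contradiction e≺f (<-asym f≺e)) ]′ (agree e<f gf<ge))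
    (λ e<f gf<ge f≺e → [ (λ (e≺f , _) → contradiction f≺e (<-asym e≺f)) , proj₂ ]′ (agree e<f gf<ge))
    (v ⟨ i ⟩))
  where
  O = topOrder S
  open SeparableOrder O using (_≺_)
  g = y · v ⁻¹

  agree : ∀ {e f} → e < f → g ⟨ f ⟩ < g ⟨ e ⟩ →
          (e ≺ f × g ⟨ e ⟩ ≺ g ⟨ f ⟩) ⊎ (f ≺ e × g ⟨ f ⟩ ≺ g ⟨ e ⟩)
  agree {e} {f} e<f gf<ge = [ inj₁ ∘ descends , inj₂ ∘ ascends ]′ (≢⇒<⊎> (Fin.<⇒≢ e<f ∘ injective (v ⁻¹)))
    where
    s t : Fin n
    s = v ⁻¹ ⟨ e ⟩
    t = v ⁻¹ ⟨ f ⟩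

    descends : s < t → e ≺ f × g ⟨ e ⟩ ≺ g ⟨ f ⟩
    descends s<t = subst₂ _≺_ (inverseʳ v) (inverseʳ v) (on-descent V s<t wt<ws) , on-descent Y s<t wt<ws
      where
      wt<ws : w ⟨ t ⟩ < w ⟨ s ⟩
      wt<ws = ≮∧≢⇒> (λ ws<wt → <-asym gf<ge (on-ascent Y s<t ws<wt)) (Fin.<⇒≢ s<t ∘ injective w)

    ascends : t < s → f ≺ e × g ⟨ f ⟩ ≺ g ⟨ e ⟩
    ascends t<s = subst₂ _≺_ (inverseʳ v) (inverseʳ v) (on-descent V t<s ws<wt) , on-descent Y t<s ws<wt
      where
      ws<wt : w ⟨ s ⟩ < w ⟨ t ⟩
      ws<wt = ≮∧≢⇒> (λ wt<ws → <-asym e<f (subst₂ _<_ (inverseʳ v) (inverseʳ v) (on-ascent V t<s wt<ws)))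
                    (Fin.<⇒≢ t<s ∘ injective w)

-- Membership in `X` and `Y`.

-- Since `w` undoes no inversion of `y₀`, the identity is a labelling of `w`; so the right factor of
-- `w` is trivial.
reduced⇒X : (S : Splitting a b n) (w : Permutation′ n) → Reduced w (y₀ S) → X S w
reduced⇒X S w red with factor S w
... | x , y , x∈X , y∈Y , eq = X-resp S x≈w x∈X
  where
  trivial : Labelling S w id
  trivial = record
    { on-ascent  = λ i<j _ → i<j
    ; on-descent = λ i<j wj<wi → ≮∧≢⇒>
        (λ uj<ui → <-asym wj<wi (subst₂ (λ c d → w ⟨ c ⟩ < w ⟨ d ⟩) (inverseʳ (y₀ S)) (inverseʳ (y₀ S))
          (red uj<ui (subst₂ _<_ (sym (inverseʳ (y₀ S))) (sym (inverseʳ (y₀ S))) i<j))))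
        (Fin.<⇒≢ i<j ∘ sym ∘ injective (y₀ S ⁻¹)) }
  y≈id : y ≈ id
  y≈id = labelling-unique S w id y trivial (factor-labelling S x∈X y∈Y eq)
  x≈w : x ≈ w
  x≈w i = trans (cong (x ⟨_⟩) (sym (y≈id i))) (eq i)

-- Here `y₀ ⁻¹ · y` is `z ⁻¹`, which increases on descents of `y` by reducedness. Thus `y` labels
-- itself and equals its own right factor.
below-top⇒Y : (S : Splitting a b n) (y z : Permutation′ n) → y₀ S ≈ y · z → Reduced y z → Y S y
below-top⇒Y S y z y₀≈yz red with factor S y
... | x , y′ , x∈X , y′∈Y , eq = Y-resp S y′≈y y′∈Y
  where
  u≡ : ∀ i → y₀ S ⁻¹ ⟨ y ⟨ i ⟩ ⟩ ≡ z ⁻¹ ⟨ i ⟩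
  u≡ i = sym (preimage (y₀ S) (trans (y₀≈yz _) (cong (y ⟨_⟩) (inverseʳ z))))
  trivial : Labelling S y y
  trivial = record
    { on-ascent  = λ _ yi<yj → yi<yj
    ; on-descent = λ i<j yj<yi → subst₂ _<_ (sym (u≡ _)) (sym (u≡ _)) (≮∧≢⇒>
        (λ zj<zi → <-asym yj<yi (subst₂ (λ c d → y ⟨ c ⟩ < y ⟨ d ⟩) (inverseʳ z) (inverseʳ z)
          (red zj<zi (subst₂ _<_ (sym (inverseʳ z)) (sym (inverseʳ z)) i<j))))
        (Fin.<⇒≢ i<j ∘ sym ∘ injective (z ⁻¹))) }
  y′≈y : y′ ≈ y
  y′≈y = labelling-unique S y y y′ trivial (factor-labelling S x∈X y′∈Y eq)

-- An inversion of `y ⁻¹ · y₀` undone by `y` is an inversion of `y` whose labels `y₀` meets in the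
-- order forbidden by `Y-inversion`.
Y⇒below-top : (S : Splitting a b n) (y : Permutation′ n) → Y S y → Reduced y (y ⁻¹ · y₀ S)
Y⇒below-top S y y∈Y {i} {j} i<j zj<zi = subst₂ _<_ (sym (inverseʳ y)) (sym (inverseʳ y)) (≮∧≢⇒>
  (λ yi<yj → <-asym i<j (subst₂ _<_ (u≡ _) (u≡ _)
    (Y-inversion S y y∈Y zj<zi (subst₂ _<_ (sym (inverseʳ y)) (sym (inverseʳ y)) yi<yj))))
  (Fin.<⇒≢ i<j ∘ injective (y₀ S)))
  where
  u≡ : ∀ i → y₀ S ⁻¹ ⟨ y ⟨ y ⁻¹ ⟨ y₀ S ⟨ i ⟩ ⟩ ⟩ ⟩ ≡ i
  u≡ i = trans (cong (y₀ S ⁻¹ ⟨_⟩) (inverseʳ y)) (inverseˡ (y₀ S))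

splitting : {X : Pred (Permutation′ n) a} {Y : Pred (Permutation′ n) b} → IsSplitting X Y → Splitting a b n
splitting {n = n} {X = X} {Y} isSplitting = record
  { X = X ; Y = Y ; X-resp = X-resp-≈ ; Y-resp = Y-resp-≈
  ; factor = factors
  ; unique = λ x x′ y y′ x∈ x′∈ y∈ y′∈ eq →
      proj₁ (proj₁ bijective {(x , x∈) , (y , y∈)} {(x′ , x′∈) , (y′ , y′∈)} eq)
  ; reduced = λ x y x∈ y∈ → additive⇒reduced x y (additive x y x∈ y∈)
  ; x₀ = proj₁ top-factors ; y₀ = proj₁ (proj₂ top-factors)
  ; x₀∈X = proj₁ (proj₂ (proj₂ top-factors))
  ; y₀∈Y = proj₁ (proj₂ (proj₂ (proj₂ top-factors)))
  ; top = proj₂ (proj₂ (proj₂ (proj₂ top-factors)))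
  }
  where
  open IsSplitting isSplitting
  factors : ∀ w → ∃₂ λ x y → X x × Y y × (∀ i → x ⟨ y ⟨ i ⟩ ⟩ ≡ w ⟨ i ⟩)
  factors w with proj₂ bijective w
  ... | ((x , x∈X) , (y , y∈Y)) , eq =
    x , y , x∈X , y∈Y , eq {(x , x∈X) , (y , y∈Y)} ((λ _ → refl) , (λ _ → refl))
  top-factors = factors reverse

theorem4p4 : {a b : Level} (n : ℕ) (X : Pred (Permutation′ n) a) (Y : Pred (Permutation′ n) b) →
    IsSplitting X Y →
    (X ≐ W/ Y) × Σ (Permutation′ n) (λ u → Separable u × (Y ≐ [e, u ]R))
theorem4p4 n X Y isSplitting =
  ((λ {x} x∈X y y∈Y → additive x y x∈X y∈Y) ,
   (λ {w} w∈W/Y → reduced⇒X S w (additive⇒reduced w u (w∈W/Y u (y₀∈Y S))))) ,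
  u , top-separable S ,
  (λ {y} y∈Y → y ⁻¹ · u , (λ i → sym (inverseʳ y)) , y-below y y∈Y) ,
  (λ {y} (z , u≈yz , ℓu≡) → below-top⇒Y S y z u≈yz
    (additive⇒reduced y z (trans (sym (ℓ-cong {v = u} {y · z} u≈yz)) ℓu≡)))
  where
  open IsSplitting isSplitting using (additive)
  S = splitting isSplitting
  u = y₀ S
  y-below : ∀ y → Y y → ℓ u ≡ ℓ y + ℓ (y ⁻¹ · u)
  y-below y y∈Y = trans (ℓ-cong {v = u} {y · (y ⁻¹ · u)} λ i → sym (inverseʳ y))
    (reduced⇒additive y (y ⁻¹ · u) (Y⇒below-top S y y∈Y))
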